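{- Let $\Gamma$ be a group and let $A\subseteq\Gamma$ be a finite subset with $|A\cdot A|\le K|A|$ for some positive integer $K$, where $A\cdot A=\{aa':a,a'\in A\}$. Then $\dim A\le O\big((\log|A|)^{1+o(1)}\big)$, where the implicit constants may depend on $K$ and $o(1)\to 0$ as $|A|\to\infty$.
   Context: Let $(\Gamma,\cdot)$ be a group with identity $e$. A subset $S\subseteq\Gamma$ is dissociated if there is no solution to $g_1^{\varepsilon_1}\cdots g_m^{\varepsilon_m}=e$ with $m\ge1$, $\varepsilon_i\in\{1,-1\}$ for all $i$, and $g_1,\dots,g_m\in S$ distinct. The additive dimension $\dim A$ of a subset $A\subseteq\Gamma$ is the maximum size of a dissociated subset of $A$. -}

module Defs where

open import Level using (_⊔_)
open import Algebra.Bundles using (Group)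
open import Data.Nat using (ℕ; _≤_; _*_)
open import Data.Fin using (Fin)
open import Data.Bool using (Bool; true; false)
open import Data.Product using (_×_; Σ; proj₁; _,_)
open import Data.List using (List; []; _∷_; length; map)
open import Data.List.Relation.Unary.Unique.Propositional using (Unique)
import Data.List.Relation.Unary.Unique.Setoid as USet
import Data.List.Membership.Setoid as MSet
open import Relation.Binary.PropositionalEquality using (_≡_; _≢_)
open import Relation.Nullary using (¬_)

module _ {c ℓ} (G : Group c ℓ) where
  open Group G
  open MSet setoid using (_∈_)

  signedPow : Bool → Carrier → Carrier
  signedPow true  g = g
  signedPow false g = g ⁻¹

  evalWord : ∀ {k} → (Fin k → Carrier) → List (Fin k × Bool) → Carrier
  evalWord S []            = ε
  evalWord S ((i , s) ∷ w) = signedPow s (S i) ∙ evalWord S w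

  Distinct : ∀ {k} → (Fin k → Carrier) → Set ℓ
  Distinct S = ∀ i j → S i ≈ S j → i ≡ j

  Dissociated : ∀ {k} → (Fin k → Carrier) → Set ℓ
  Dissociated {k} S =
    (w : List (Fin k × Bool)) → w ≢ [] → Unique (map proj₁ w) → ¬ (evalWord S w ≈ ε)

  DissociatedSubsetOf : List Carrier → ∀ {k} → (Fin k → Carrier) → Set (c ⊔ ℓ)
  DissociatedSubsetOf A S = Distinct S × (∀ i → S i ∈ A) × Dissociated S

  FiniteSubset : List Carrier → Set (c ⊔ ℓ)
  FiniteSubset A = USet.Unique setoid A

  ProductSetAtMost : List Carrier → ℕ → Set (c ⊔ ℓ)
  ProductSetAtMost A m =
    Σ (List Carrier) λ L → length L ≤ m × (∀ {a a'} → a ∈ A → a' ∈ A → (a ∙ a') ∈ L)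

{-# OPTIONS --safe #-}
-- The bipartite graph joining a ∈ A to a ∙ s ∈ A ∙ A by an edge of colour s has at most (K + 1)|A| vertices, k|A|
-- edges, each colour class is a matching, and a closed walk using no colour twice would contradict dissociation.
-- Pass to a smallest vertex set H on which edges / (|H| log |H|) is at least as large as on the whole graph; then
-- every X ⊆ H has at least of order (k / log |A|) |X| log (|H| / |X|) boundary edges. Fix a root in H; let R C be
-- the set of vertices joined to it by rainbow walks in H with colours from C, and gap C = log |H| - log |R C|. A
-- boundary edge of R C whose colour c is not in C makes R (C ∪ c) larger; if c ∈ C, its inner end is not in R (C ∖
-- c). Either way it is counted by |R (C ∪ c)| - |R (C ∖ c)|, so averaging over all C of size i shows that the mean
-- gap on level i + 2 is at most 1 - 1 / O(log |A|) times that on level i. As R C and R (∁ C) meet only in the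
-- root, the mean gap on level about k / 2 is bounded below, hence k = O(log |A| log log |A|).
module Submission where

open import Defs
open import Level using (Level)
open import Algebra.Bundles using (Group)
import Algebra.Properties.Group as GroupProperties
open import Data.Bool using (Bool; true; false; not; _∧_; _xor_)
import Data.Bool.Properties as Bool
open import Data.Fin using (Fin; zero; suc; _↑ˡ_; _↑ʳ_; splitAt; punchIn; punchOut)
import Data.Fin.Properties as Fin
open import Data.Fin.Subset using (Subset; ∁; ⊥; ∣_∣; inside; outside)
open import Data.Fin.Subset.Properties using (anySubset?)
open import Data.List using (List; []; _∷_; length; map) renaming (lookup to _‼_)
open import Data.List.Membership.Propositional.Properties using (∈-lookup)
import Data.List.Membership.Setoid as Membership
import Data.List.Membership.Setoid.Properties as MembershipProperties
open import Data.List.Relation.Unary.All as All using (All; []; _∷_)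
open import Data.List.Relation.Unary.AllPairs using ([]; _∷_)
open import Data.List.Relation.Unary.Any using (index)
open import Data.List.Relation.Unary.Any.Properties using (lookup-index)
open import Data.List.Relation.Unary.Unique.Propositional using (Unique)
import Data.List.Relation.Unary.Unique.Setoid as UniqueSetoid
open import Data.Nat using (ℕ; zero; suc; _+_; _*_; _∸_; _^_; _/_; _!; _≤_; _<_; _≟_; _<?_; z≤n; s≤s; s≤s⁻¹; NonZero; >-nonZero; >-nonZero⁻¹)
open import Data.Nat.DivMod using (/-monoʳ-≤; m/n*n≤m; m≡m%n+[m/n]*n; m%n<n)
open import Data.Nat.Induction using (<-wellFounded)
open import Data.Nat.Logarithm using (⌊log₂_⌋; ⌊log₂⌋-mono-≤; ⌊log₂[2^n]⌋≡n)
open import Data.Nat.Properties hiding (_≟_; _<?_)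
open import Data.Nat.Tactic.RingSolver using (solve-∀)
open import Data.Product using (Σ; ∃; ∃₂; _×_; _,_; proj₁; proj₂)
open import Data.Sum using (_⊎_; inj₁; inj₂; [_,_]′)
open import Data.Vec using ([]; _∷_; _[_]≔_; lookup; tabulate)
open import Data.Vec.Properties using (lookup∘tabulate; lookup∘updateAt; lookup∘updateAt′; lookup-map; map-[]≔; []≔-idempotent; []≔-lookup)
open import Function using (_∘_)
open import Induction.WellFounded using (Acc; acc)
open import Relation.Binary.Bundles using (Setoid)
open import Relation.Binary.PropositionalEquality hiding (setoid)
open import Relation.Nullary using (Dec; yes; no; does; contradiction)
open import Relation.Nullary.Decidable using (_×-dec_; _⊎-dec_; dec-true)
open import Algebra.Properties.Semiring.Sum +-*-semiring
  using (sum; sum-cong-≗; sum-remove; ∑-distrib-+; *-distribˡ-sum)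

-- Sums over the subsets of a given size

sum-mono-≤ : ∀ {n} {f g : Fin n → ℕ} → (∀ i → f i ≤ g i) → sum f ≤ sum g
sum-mono-≤ {zero}  f≤g = z≤n
sum-mono-≤ {suc n} f≤g = +-mono-≤ (f≤g zero) (sum-mono-≤ (f≤g ∘ suc))

sum-const : ∀ n x → sum {n} (λ _ → x) ≡ n * x
sum-const zero    x = refl
sum-const (suc n) x = cong (x +_) (sum-const n x)

≤-sum : ∀ {n} (f : Fin n → ℕ) i → f i ≤ sum f
≤-sum f zero    = m≤m+n _ _
≤-sum f (suc i) = m≤n⇒m≤o+n (f zero) (≤-sum (f ∘ suc) i)

∁-involutive : ∀ {m} (C : Subset m) → ∁ (∁ C) ≡ C
∁-involutive []      = refl
∁-involutive (b ∷ C) = cong₂ _∷_ (Bool.not-involutive b) (∁-involutive C)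

off on : ∀ {m} → (Subset (suc m) → ℕ) → Subset m → ℕ
off F C = F (outside ∷ C)
on  F C = F (inside ∷ C)

-- The sum of F over the subsets with exactly i elements inside and t outside; it is 0 unless i + t = m.
levelSum : ∀ {m} → ℕ → ℕ → (Subset m → ℕ) → ℕ
levelSum {zero}  zero    zero    F = F []
levelSum {zero}  zero    (suc t) F = 0
levelSum {zero}  (suc i) t       F = 0
levelSum {suc m} zero    zero    F = 0
levelSum {suc m} zero    (suc t) F = levelSum zero t (off F)
levelSum {suc m} (suc i) zero    F = levelSum i zero (on F)
levelSum {suc m} (suc i) (suc t) F =
  levelSum (suc i) t (off F) + levelSum i (suc t) (on F)

levelSum-mono-≤ : ∀ {m} i t {F G : Subset m → ℕ} → (∀ C → F C ≤ G C) → levelSum i t F ≤ levelSum i t G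
levelSum-mono-≤ {zero}  zero    zero    F≤G = F≤G []
levelSum-mono-≤ {zero}  zero    (suc t) F≤G = z≤n
levelSum-mono-≤ {zero}  (suc i) t       F≤G = z≤n
levelSum-mono-≤ {suc m} zero    zero    F≤G = z≤n
levelSum-mono-≤ {suc m} zero    (suc t) {F} {G} F≤G =
  levelSum-mono-≤ zero t {off F} {off G} λ C → F≤G (outside ∷ C)
levelSum-mono-≤ {suc m} (suc i) zero    {F} {G} F≤G =
  levelSum-mono-≤ i zero {on F} {on G} λ C → F≤G (inside ∷ C)
levelSum-mono-≤ {suc m} (suc i) (suc t) {F} {G} F≤G =
  +-mono-≤ (levelSum-mono-≤ (suc i) t {off F} {off G} λ C → F≤G (outside ∷ C))
           (levelSum-mono-≤ i (suc t) {on F} {on G} λ C → F≤G (inside ∷ C))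

levelSum-cong : ∀ {m} i t {F G : Subset m → ℕ} → (∀ C → F C ≡ G C) → levelSum i t F ≡ levelSum i t G
levelSum-cong i t F≡G = ≤-antisym (levelSum-mono-≤ i t (≤-reflexive ∘ F≡G))
                                  (levelSum-mono-≤ i t (≤-reflexive ∘ sym ∘ F≡G))

+-interchange : ∀ a b c d → (a + b) + (c + d) ≡ (a + c) + (b + d)
+-interchange = solve-∀

levelSum-+ : ∀ {m} i t (F G : Subset m → ℕ) →
  levelSum i t (λ C → F C + G C) ≡ levelSum i t F + levelSum i t G
levelSum-+ {zero}  zero    zero    F G = refl
levelSum-+ {zero}  zero    (suc t) F G = refl
levelSum-+ {zero}  (suc i) t       F G = refl
levelSum-+ {suc m} zero    zero    F G = refl
levelSum-+ {suc m} zero    (suc t) F G = levelSum-+ zero t (off F) (off G)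
levelSum-+ {suc m} (suc i) zero    F G = levelSum-+ i zero (on F) (on G)
levelSum-+ {suc m} (suc i) (suc t) F G =
  trans (cong₂ _+_ (levelSum-+ (suc i) t (off F) (off G)) (levelSum-+ i (suc t) (on F) (on G)))
        (+-interchange (levelSum (suc i) t (off F)) _ _ _)

levelSum-* : ∀ {m} i t x (F : Subset m → ℕ) → levelSum i t (λ C → x * F C) ≡ x * levelSum i t F
levelSum-* {zero}  zero    zero    x F = refl
levelSum-* {zero}  zero    (suc t) x F = sym (*-zeroʳ x)
levelSum-* {zero}  (suc i) t       x F = sym (*-zeroʳ x)
levelSum-* {suc m} zero    zero    x F = sym (*-zeroʳ x)
levelSum-* {suc m} zero    (suc t) x F = levelSum-* zero t x (off F)
levelSum-* {suc m} (suc i) zero    x F = levelSum-* i zero x (on F)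
levelSum-* {suc m} (suc i) (suc t) x F =
  trans (cong₂ _+_ (levelSum-* (suc i) t x (off F)) (levelSum-* i (suc t) x (on F)))
        (sym (*-distribˡ-+ x _ _))

levelSum-∁ : ∀ {m} i t (F : Subset m → ℕ) → levelSum i t (F ∘ ∁) ≡ levelSum t i F
levelSum-∁ {zero}  zero    zero    F = refl
levelSum-∁ {zero}  zero    (suc t) F = refl
levelSum-∁ {zero}  (suc i) zero    F = refl
levelSum-∁ {zero}  (suc i) (suc t) F = refl
levelSum-∁ {suc m} zero    zero    F = refl
levelSum-∁ {suc m} zero    (suc t) F = levelSum-∁ zero t (on F)
levelSum-∁ {suc m} (suc i) zero    F = levelSum-∁ i zero (off F)
levelSum-∁ {suc m} (suc i) (suc t) F =
  trans (cong₂ _+_ (levelSum-∁ (suc i) t (on F)) (levelSum-∁ i (suc t) (off F)))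
        (+-comm (levelSum t (suc i) (on F)) _)

levelSum-⊥ : ∀ {m} (F : Subset m → ℕ) → levelSum 0 m F ≡ F ⊥
levelSum-⊥ {zero}  F = refl
levelSum-⊥ {suc m} F = levelSum-⊥ (off F)

-- Both sums run over all `m` colours. A colour already on the requested side leaves `C` unchanged
-- and contributes `F C`.
up down : ∀ {m} → (Subset m → ℕ) → Subset m → ℕ
up   F C = sum λ c → F (C [ c ]≔ inside)
down F C = sum λ c → F (C [ c ]≔ outside)


-- With nothing outside, only the full set can occur, and each of its `i` updates is idle.
levelSum-up-⊤ : ∀ {m} i (F : Subset m → ℕ) → levelSum i zero (up F) ≡ i * levelSum i zero F
levelSum-up-⊤ {zero}  zero    F = refl
levelSum-up-⊤ {zero}  (suc i) F = sym (*-zeroʳ i)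
levelSum-up-⊤ {suc m} zero    F = refl
levelSum-up-⊤ {suc m} (suc i) F =
  trans (levelSum-+ i zero _ (up (on F)))
        (cong (levelSum i zero (on F) +_) (levelSum-up-⊤ i (on F)))

-- Double counting: a set with `suc i` elements arises by insertion from `suc i` sets one smaller,
-- and each set of size `i` is returned unchanged by its own `i` elements.
levelSum-up : ∀ {m} i t (F : Subset m → ℕ) →
  levelSum i (suc t) (up F) ≡ suc i * levelSum (suc i) t F + i * levelSum i (suc t) F
levelSum-up {zero}  zero    t       F = refl
levelSum-up {zero}  (suc i) t       F = sym (cong₂ _+_ (*-zeroʳ (suc (suc i))) (*-zeroʳ (suc i)))
levelSum-up {suc m} zero    zero    F =
  trans (levelSum-+ zero zero _ (up (off F)))
        (trans (cong (levelSum zero zero (on F) +_) (levelSum-up-⊤ zero (off F)))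
               (sym (+-assoc _ 0 0)))
levelSum-up {suc m} zero    (suc t) F =
  trans (levelSum-+ zero (suc t) _ (up (off F)))
        (trans (cong (levelSum zero (suc t) (on F) +_) (levelSum-up zero t (off F)))
               (arith (levelSum zero (suc t) (on F)) _))
  where
  arith : ∀ a b → a + (1 * b + 0) ≡ 1 * (b + a) + 0
  arith = solve-∀
levelSum-up {suc m} (suc i) zero    F =
  trans (cong₂ _+_ (trans (levelSum-+ (suc i) zero _ (up (off F)))
                          (cong (levelSum (suc i) zero (on F) +_)
                                (levelSum-up-⊤ (suc i) (off F))))
                   (trans (levelSum-+ i 1 _ (up (on F)))
                          (cong (levelSum i 1 (on F) +_) (levelSum-up i zero (on F)))))
        (arith i (levelSum (suc i) zero (on F)) _ _)
  where
  arith : ∀ i a b c → (a + suc i * b) + (c + (suc i * a + i * c)) ≡ suc (suc i) * a + suc i * (b + c)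
  arith = solve-∀
levelSum-up {suc m} (suc i) (suc t) F =
  trans (cong₂ _+_ (trans (levelSum-+ (suc i) (suc t) _ (up (off F)))
                          (cong (levelSum (suc i) (suc t) (on F) +_)
                                (levelSum-up (suc i) t (off F))))
                   (trans (levelSum-+ i (suc (suc t)) _ (up (on F)))
                          (cong (levelSum i (suc (suc t)) (on F) +_)
                                (levelSum-up i (suc t) (on F)))))
        (arith i (levelSum (suc i) (suc t) (on F)) (levelSum (suc (suc i)) t (off F))
               (levelSum (suc i) (suc t) (off F)) (levelSum i (suc (suc t)) (on F)))
  where
  arith : ∀ i a b c d →
    (a + (suc (suc i) * b + suc i * c)) + (d + (suc i * a + i * d)) ≡
    suc (suc i) * (b + a) + suc i * (c + d)
  arith = solve-∀

-- Complementation turns removal into insertion, so this is `levelSum-up` read through `∁`.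
levelSum-down : ∀ {m} i t (F : Subset m → ℕ) →
  levelSum (suc i) t (down F) ≡ t * levelSum (suc i) t F + suc t * levelSum i (suc t) F
levelSum-down i t F = begin
  levelSum (suc i) t (down F)              ≡⟨ levelSum-cong (suc i) t down≡up∘∁ ⟩
  levelSum (suc i) t (up (F ∘ ∁) ∘ ∁)      ≡⟨ levelSum-∁ (suc i) t (up (F ∘ ∁)) ⟩
  levelSum t (suc i) (up (F ∘ ∁))          ≡⟨ levelSum-up t i (F ∘ ∁) ⟩
  suc t * levelSum (suc t) i (F ∘ ∁) + t * levelSum t (suc i) (F ∘ ∁)
    ≡⟨ cong₂ (λ x y → suc t * x + t * y) (levelSum-∁ (suc t) i F) (levelSum-∁ t (suc i) F) ⟩
  suc t * levelSum i (suc t) F + t * levelSum (suc i) t F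
    ≡⟨ +-comm (suc t * levelSum i (suc t) F) _ ⟩
  t * levelSum (suc i) t F + suc t * levelSum i (suc t) F ∎
  where
  open ≡-Reasoning
  down≡up∘∁ : ∀ C → down F C ≡ up (F ∘ ∁) (∁ C)
  down≡up∘∁ C = sum-cong-≗ λ c → cong F (sym
    (trans (map-[]≔ not (∁ C) c) (cong (_[ c ]≔ outside) (∁-involutive C))))

-- i! t! levelSum i t F is the sum, over all orderings of the ground set, of F at the set of the first i elements.
orderingSum : ∀ {m} → ℕ → ℕ → (Subset m → ℕ) → ℕ
orderingSum i t F = i ! * t ! * levelSum i t F

orderingSum-mono-≤ : ∀ {m} i t {F G : Subset m → ℕ} → (∀ C → F C ≤ G C) → orderingSum i t F ≤ orderingSum i t G
orderingSum-mono-≤ i t F≤G = *-monoʳ-≤ (i ! * t !) (levelSum-mono-≤ i t F≤G)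

orderingSum-+ : ∀ {m} i t (F G : Subset m → ℕ) →
  orderingSum i t (λ C → F C + G C) ≡ orderingSum i t F + orderingSum i t G
orderingSum-+ i t F G = trans (cong (i ! * t ! *_) (levelSum-+ i t F G)) (*-distribˡ-+ (i ! * t !) _ _)

orderingSum-* : ∀ {m} i t x (F : Subset m → ℕ) → orderingSum i t (λ C → x * F C) ≡ x * orderingSum i t F
orderingSum-* i t x F = trans (cong (i ! * t ! *_) (levelSum-* i t x F)) (swap (i ! * t !) x _)
  where
  swap : ∀ a b c → a * (b * c) ≡ b * (a * c)
  swap = solve-∀

orderingSum-∁ : ∀ {m} i t (F : Subset m → ℕ) → orderingSum i t (F ∘ ∁) ≡ orderingSum t i F
orderingSum-∁ i t F = cong₂ _*_ (*-comm (i !) (t !)) (levelSum-∁ i t F)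

orderingSum-⊥ : ∀ {m} (F : Subset m → ℕ) → orderingSum 0 m F ≡ m ! * F ⊥
orderingSum-⊥ {m} F = cong₂ _*_ (+-identityʳ (m !)) (levelSum-⊥ F)

-- The factorials equalise the sizes of the levels: of the `i + suc t` colours, `suc t` lead to the
-- next level and `i` are idle, so the coefficients act as transition probabilities.
orderingSum-up : ∀ {m} i t (F : Subset m → ℕ) →
  orderingSum i (suc t) (up F) ≡ suc t * orderingSum (suc i) t F + i * orderingSum i (suc t) F
orderingSum-up i t F = trans (cong (i ! * suc t ! *_) (levelSum-up i t F)) (arith i t (i !) (t !) _ _)
  where
  arith : ∀ i t a b x y →
    a * (suc t * b) * (suc i * x + i * y) ≡ suc t * (suc i * a * b * x) + i * (a * (suc t * b) * y)
  arith = solve-∀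

orderingSum-down : ∀ {m} i t (F : Subset m → ℕ) →
  orderingSum (suc i) t (down F) ≡ t * orderingSum (suc i) t F + suc i * orderingSum i (suc t) F
orderingSum-down i t F = trans (cong (suc i ! * t ! *_) (levelSum-down i t F)) (arith i t (i !) (t !) _ _)
  where
  arith : ∀ i t a b x y →
    (suc i * a) * b * (t * x + suc t * y) ≡ t * (suc i * a * b * x) + suc i * (a * (suc t * b) * y)
  arith = solve-∀

-- Induction on `i`: for a constant function `up` multiplies by `m`, which is `suc t + i`, and the
-- idle part cancels in `orderingSum-up`. The factor `m !` counts the orderings.
orderingSum-const : ∀ {m} i t x → i + t ≡ m → orderingSum {m} i t (λ _ → x) ≡ m ! * x
orderingSum-const zero t x refl = orderingSum-⊥ {t} (λ _ → x)
orderingSum-const {m} (suc i) t x i+t≡m = *-cancelˡ-≡ _ _ (suc t) (+-cancelʳ-≡ (i * (m ! * x)) _ _ (begin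
  suc t * orderingSum (suc i) t const-x + i * (m ! * x)
    ≡⟨ cong (λ y → suc t * orderingSum (suc i) t const-x + i * y) IH ⟨
  suc t * orderingSum (suc i) t const-x + i * orderingSum i (suc t) const-x
    ≡⟨ orderingSum-up i t const-x ⟨
  orderingSum i (suc t) (up const-x)        ≡⟨ cong (i ! * suc t ! *_) (levelSum-cong i (suc t) {up const-x} λ _ → sum-const m x) ⟩
  orderingSum {m} i (suc t) (λ _ → m * x)   ≡⟨ orderingSum-* i (suc t) m const-x ⟩
  m * orderingSum i (suc t) const-x         ≡⟨ cong (m *_) IH ⟩
  m * (m ! * x)                             ≡⟨ cong (_* (m ! * x)) (trans (sym (trans (+-suc i t) i+t≡m)) (+-comm i (suc t))) ⟩
  (suc t + i) * (m ! * x)                   ≡⟨ *-distribʳ-+ (m ! * x) (suc t) i ⟩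
  suc t * (m ! * x) + i * (m ! * x)         ∎))
  where
  open ≡-Reasoning
  const-x : Subset m → ℕ
  const-x _ = x
  IH : orderingSum {m} i (suc t) const-x ≡ m ! * x
  IH = orderingSum-const i (suc t) x (trans (+-suc i t) i+t≡m)

-- Geometric decay along the levels of the Boolean lattice

-- These are the first two terms of the binomial expansion.
bernoulli : ∀ a n → a ^ suc n + suc n * a ^ n ≤ suc a ^ suc n
bernoulli a zero    = ≤-reflexive (arith a)
  where
  arith : ∀ a → a * 1 + 1 * 1 ≡ suc a * 1
  arith = solve-∀
bernoulli a (suc n) = begin
  a ^ suc (suc n) + suc (suc n) * a ^ suc n                  ≤⟨ m≤m+n _ (suc n * a ^ n) ⟩
  a ^ suc (suc n) + suc (suc n) * a ^ suc n + suc n * a ^ n  ≡⟨ arith a n (a ^ n) ⟩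
  suc a * (a ^ suc n + suc n * a ^ n)                        ≤⟨ *-monoʳ-≤ (suc a) (bernoulli a n) ⟩
  suc a ^ suc (suc n)                                        ∎
  where
  open ≤-Reasoning
  arith : ∀ a n p → a * (a * p) + suc (suc n) * (a * p) + suc n * p ≡ suc a * (a * p + suc n * p)
  arith = solve-∀

^-distribʳ-* : ∀ n a b → (a * b) ^ n ≡ a ^ n * b ^ n
^-distribʳ-* zero    a b = refl
^-distribʳ-* (suc n) a b = trans (cong (a * b *_) (^-distribʳ-* n a b)) (arith a b (a ^ n) (b ^ n))
  where
  arith : ∀ a b c d → a * b * (c * d) ≡ a * c * (b * d)
  arith = solve-∀

-- The inequality (1 + 1/a)^a ≥ 2: with exponent `a`, the second Bernoulli term is another copy of
-- `a ^ a`.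
2*a^a≤[1+a]^a : ∀ a → .{{NonZero a}} → 2 * a ^ a ≤ suc a ^ a
2*a^a≤[1+a]^a (suc a) = ≤-trans (≤-reflexive (cong (suc a ^ suc a +_) (+-identityʳ _))) (bernoulli (suc a) a)

-- Here `g` stands for the gap. Summed over one level, `g-contraction` compares the level above with
-- the level below.
module Decay {k : ℕ} (g : Subset k → ℕ) (M : ℕ)
  (g-antitone    : ∀ C c → g (C [ c ]≔ inside) ≤ g C)
  (g-contraction : ∀ C → M * up g C + k * g C ≤ M * down g C)
  where

  Γ : ℕ → ℕ → ℕ
  Γ i t = orderingSum i t g

  Γ-antitone : ∀ i t → i + suc t ≡ k → Γ (suc i) t ≤ Γ i (suc t)
  Γ-antitone i t i+t≡k = *-cancelˡ-≤ (suc t) (+-cancelʳ-≤ (i * Γ i (suc t)) _ _ (begin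
    suc t * Γ (suc i) t + i * Γ i (suc t)    ≡⟨ orderingSum-up i t g ⟨
    orderingSum i (suc t) (up g)             ≤⟨ orderingSum-mono-≤ i (suc t) up-g≤k*g ⟩
    orderingSum i (suc t) (λ C → k * g C)    ≡⟨ orderingSum-* i (suc t) k g ⟩
    k * Γ i (suc t)                          ≡⟨ cong (_* Γ i (suc t)) (trans (sym i+t≡k) (+-comm i (suc t))) ⟩
    (suc t + i) * Γ i (suc t)                ≡⟨ *-distribʳ-+ (Γ i (suc t)) (suc t) i ⟩
    suc t * Γ i (suc t) + i * Γ i (suc t)    ∎))
    where
    open ≤-Reasoning
    up-g≤k*g : ∀ C → up g C ≤ k * g C
    up-g≤k*g C = ≤-trans (sum-mono-≤ (g-antitone C)) (≤-reflexive (sum-const k (g C)))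

  Γ-antitone* : ∀ i d t → i + (d + t) ≡ k → Γ (d + i) t ≤ Γ i (d + t)
  Γ-antitone* i zero    t i+t≡k = ≤-refl
  Γ-antitone* i (suc d) t i+t≡k = begin
    Γ (suc (d + i)) t  ≡⟨ cong (λ x → Γ x t) (+-suc d i) ⟨
    Γ (d + suc i) t    ≤⟨ Γ-antitone* (suc i) d t (trans (sym (+-suc i (d + t))) i+t≡k) ⟩
    Γ (suc i) (d + t)  ≤⟨ Γ-antitone i (d + t) i+t≡k ⟩
    Γ i (suc (d + t))  ∎
    where open ≤-Reasoning

  -- Sum the hypothesis over the middle level `suc i`. The idle updates produce copies of the middle
  -- value `y`; as z ≤ y ≤ x, they may be lowered to `z` on the left and raised to `x` on the right,
  -- after which the number of colours cancels.
  Γ-contraction : ∀ i t → i + suc (suc t) ≡ k → suc M * Γ (suc (suc i)) t ≤ M * Γ i (suc (suc t))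
  Γ-contraction i t i+t≡k = *-cancelˡ-≤ (suc t + suc i) (begin
    (suc t + suc i) * (suc M * z)                       ≡⟨ expand M (suc t) (suc i) z ⟩
    M * (suc t * z + suc i * z) + (suc t + suc i) * z
      ≤⟨ +-mono-≤ (*-monoʳ-≤ M (+-monoʳ-≤ (suc t * z) (*-monoʳ-≤ (suc i) z≤y))) (*-monoʳ-≤ (suc t + suc i) z≤y) ⟩
    M * (suc t * z + suc i * y) + (suc t + suc i) * y
      ≡⟨ cong₂ (λ a b → M * a + b * y) (sym (orderingSum-up (suc i) t g)) k≡ ⟩
    M * orderingSum (suc i) (suc t) (up g) + k * y
      ≡⟨ cong₂ _+_ (orderingSum-* (suc i) (suc t) M (up g)) (orderingSum-* (suc i) (suc t) k g) ⟨
    orderingSum (suc i) (suc t) (λ C → M * up g C) + orderingSum (suc i) (suc t) (λ C → k * g C)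
      ≡⟨ orderingSum-+ (suc i) (suc t) (λ C → M * up g C) (λ C → k * g C) ⟨
    orderingSum (suc i) (suc t) (λ C → M * up g C + k * g C)
      ≤⟨ orderingSum-mono-≤ (suc i) (suc t) g-contraction ⟩
    orderingSum (suc i) (suc t) (λ C → M * down g C)    ≡⟨ orderingSum-* (suc i) (suc t) M (down g) ⟩
    M * orderingSum (suc i) (suc t) (down g)            ≡⟨ cong (M *_) (orderingSum-down i (suc t) g) ⟩
    M * (suc t * y + suc i * x)                         ≤⟨ *-monoʳ-≤ M (+-monoˡ-≤ (suc i * x) (*-monoʳ-≤ (suc t) y≤x)) ⟩
    M * (suc t * x + suc i * x)                         ≡⟨ collect M (suc t) (suc i) x ⟩
    (suc t + suc i) * (M * x)                           ∎)
    where
    open ≤-Reasoning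
    x y z : ℕ
    x = Γ i (suc (suc t))
    y = Γ (suc i) (suc t)
    z = Γ (suc (suc i)) t
    y≤x : y ≤ x
    y≤x = Γ-antitone i (suc t) i+t≡k
    z≤y : z ≤ y
    z≤y = Γ-antitone (suc i) t (trans (sym (+-suc i (suc t))) i+t≡k)
    k≡ : suc t + suc i ≡ k
    k≡ = trans (+-comm (suc t) (suc i)) (trans (sym (+-suc i (suc t))) i+t≡k)
    expand : ∀ M a b z → (a + b) * (suc M * z) ≡ M * (a * z + b * z) + (a + b) * z
    expand = solve-∀
    collect : ∀ M a b x → M * (a * x + b * x) ≡ (a + b) * (M * x)
    collect = solve-∀

  Γ-decay : ∀ j t → (j + j) + t ≡ k → suc M ^ j * Γ (j + j) t ≤ M ^ j * Γ 0 k
  Γ-decay zero    t refl  = ≤-refl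
  Γ-decay (suc j) t j+j+t≡k rewrite +-suc j j = begin
    suc M * suc M ^ j * Γ (suc (suc (j + j))) t    ≡⟨ swap (suc M) (suc M ^ j) _ ⟩
    suc M ^ j * (suc M * Γ (suc (suc (j + j))) t)  ≤⟨ *-monoʳ-≤ (suc M ^ j) (Γ-contraction (j + j) t shifted) ⟩
    suc M ^ j * (M * Γ (j + j) (suc (suc t)))      ≡⟨ swap′ (suc M ^ j) M _ ⟩
    M * (suc M ^ j * Γ (j + j) (suc (suc t)))      ≤⟨ *-monoʳ-≤ M (Γ-decay j (suc (suc t)) shifted) ⟩
    M * (M ^ j * Γ 0 k)                            ≡⟨ *-assoc M (M ^ j) _ ⟨
    M * M ^ j * Γ 0 k                              ∎
    where
    open ≤-Reasoning
    shifted : (j + j) + suc (suc t) ≡ k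
    shifted = trans (trans (+-suc (j + j) (suc t)) (cong suc (+-suc (j + j) t))) j+j+t≡k
    swap : ∀ a b c → a * b * c ≡ b * (a * c)
    swap = solve-∀
    swap′ : ∀ a b c → a * (b * c) ≡ b * (a * c)
    swap′ = solve-∀

  module _ (w τ : ℕ) .{{_ : NonZero w}} (g⊥≤ : g ⊥ ≤ w * τ) (g-pair : ∀ C → w ≤ 2 * (g C + g (∁ C))) where

    -- Complementation exchanges the levels `i` and `t`, so `g-pair` bounds the sum of both from
    -- below. The higher level has the smaller sum by antitonicity, so the lower one carries at
    -- least half.
    Γ-half : ∀ i t → i + t ≡ k → i ≤ t → k ! * w ≤ 4 * Γ i t
    Γ-half i t i+t≡k i≤t with m≤n⇒∃[o]m+o≡n i≤t
    ... | d , refl = begin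
      k ! * w                                       ≡⟨ orderingSum-const i (i + d) w i+t≡k ⟨
      orderingSum {k} i (i + d) (λ _ → w)           ≤⟨ orderingSum-mono-≤ i (i + d) g-pair ⟩
      orderingSum i (i + d) (λ C → 2 * (g C + g (∁ C)))  ≡⟨ orderingSum-* i (i + d) 2 (λ C → g C + g (∁ C)) ⟩
      2 * orderingSum i (i + d) (λ C → g C + g (∁ C))
        ≡⟨ cong (2 *_) (orderingSum-+ i (i + d) g (g ∘ ∁)) ⟩
      2 * (Γ i (i + d) + orderingSum i (i + d) (g ∘ ∁))
        ≡⟨ cong (λ x → 2 * (Γ i (i + d) + x)) (orderingSum-∁ i (i + d) g) ⟩
      2 * (Γ i (i + d) + Γ (i + d) i)               ≤⟨ *-monoʳ-≤ 2 (+-monoʳ-≤ (Γ i (i + d)) Γ-sym) ⟩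
      2 * (Γ i (i + d) + Γ i (i + d))               ≡⟨ quadruple (Γ i (i + d)) ⟩
      4 * Γ i (i + d)                               ∎
      where
      open ≤-Reasoning
      Γ-sym : Γ (i + d) i ≤ Γ i (i + d)
      Γ-sym rewrite +-comm i d = Γ-antitone* i d i i+t≡k
      quadruple : ∀ x → 2 * (x + x) ≡ 4 * x
      quadruple = solve-∀

    -- Decay up to level `j + j` is played against `Γ-half` there. The condition `4 * j ≤ k` keeps
    -- that level in the lower half of the lattice.
    power-bound : ∀ j → 4 * j ≤ k → suc M ^ j ≤ M ^ j * (4 * τ)
    power-bound j 4j≤k with m≤n⇒∃[o]m+o≡n 4j≤k
    ... | d , 4j+d≡k = *-cancelʳ-≤ _ _ (k ! * w) {{m*n≢0 (k !) w {{k !≢0}}}} (begin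
      suc M ^ j * (k ! * w)             ≤⟨ *-monoʳ-≤ (suc M ^ j) (Γ-half (j + j) (j + j + d) split (m≤m+n (j + j) d)) ⟩
      suc M ^ j * (4 * Γ (j + j) (j + j + d))  ≡⟨ swap (suc M ^ j) 4 _ ⟩
      4 * (suc M ^ j * Γ (j + j) (j + j + d))  ≤⟨ *-monoʳ-≤ 4 (Γ-decay j (j + j + d) split) ⟩
      4 * (M ^ j * Γ 0 k)               ≡⟨ cong (λ x → 4 * (M ^ j * x)) (orderingSum-⊥ g) ⟩
      4 * (M ^ j * (k ! * g ⊥))         ≤⟨ *-monoʳ-≤ 4 (*-monoʳ-≤ (M ^ j) (*-monoʳ-≤ (k !) g⊥≤)) ⟩
      4 * (M ^ j * (k ! * (w * τ)))     ≡⟨ collect (M ^ j) (k !) w τ ⟩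
      M ^ j * (4 * τ) * (k ! * w)       ∎)
      where
      open ≤-Reasoning
      split : j + j + (j + j + d) ≡ k
      split = trans (arith j d) 4j+d≡k
        where
        arith : ∀ j d → j + j + (j + j + d) ≡ 4 * j + d
        arith = solve-∀
      swap : ∀ a b c → a * (b * c) ≡ b * (a * c)
      swap = solve-∀
      collect : ∀ a b c d → 4 * (a * (b * (c * d))) ≡ a * (4 * d) * (b * c)
      collect = solve-∀

    -- Take `j = M * t` in `power-bound`: each block of `M` contraction steps gains a factor of at
    -- least 2.
    2^t≤4*τ : .{{_ : NonZero M}} → ∀ t → 4 * (M * t) ≤ k → 2 ^ t ≤ 4 * τ
    2^t≤4*τ t 4Mt≤k = *-cancelˡ-≤ (M ^ (M * t)) {{m^n≢0 M (M * t)}} (begin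
      M ^ (M * t) * 2 ^ t     ≡⟨ cong (_* 2 ^ t) (^-*-assoc M M t) ⟨
      (M ^ M) ^ t * 2 ^ t     ≡⟨ *-comm ((M ^ M) ^ t) _ ⟩
      2 ^ t * (M ^ M) ^ t     ≡⟨ ^-distribʳ-* t 2 (M ^ M) ⟨
      (2 * M ^ M) ^ t         ≤⟨ ^-monoˡ-≤ t (2*a^a≤[1+a]^a M) ⟩
      (suc M ^ M) ^ t         ≡⟨ ^-*-assoc (suc M) M t ⟩
      suc M ^ (M * t)         ≤⟨ power-bound (M * t) 4Mt≤k ⟩
      M ^ (M * t) * (4 * τ)   ∎)
      where open ≤-Reasoning

-- An integer logarithm

-- An integer substitute for W log: W times the harmonic numbers, with each term W/(j+1) rounded up.
module HarmonicLog (W : ℕ) where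

  slope : ℕ → ℕ
  slope j = suc (W / suc j)

  L : ℕ → ℕ
  L zero    = 0
  L (suc j) = L j + slope j

  slope-antitone : ∀ {i j} → i ≤ j → slope j ≤ slope i
  slope-antitone i≤j = s≤s (/-monoʳ-≤ W (s≤s i≤j))

  W≤[1+j]*slope : ∀ j → W ≤ suc j * slope j
  W≤[1+j]*slope j = begin
    W                                    ≡⟨ m≡m%n+[m/n]*n W (suc j) ⟩
    _ + W / suc j * suc j                ≤⟨ +-monoˡ-≤ _ (<⇒≤ (m%n<n W (suc j))) ⟩
    suc j + W / suc j * suc j            ≡⟨ *-comm (slope j) (suc j) ⟩
    suc j * slope j                      ∎
    where open ≤-Reasoning

  -- The increments involved have indices from `a` to `a + x - 1`, all at most `b`, so each is at
  -- least `slope b`.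
  L-+-≥ : ∀ a x b → a + x ≤ suc b → L a + x * slope b ≤ L (a + x)
  L-+-≥ a zero    b _ = ≤-reflexive (trans (+-identityʳ _) (cong L (sym (+-identityʳ a))))
  L-+-≥ a (suc x) b a+x≤b rewrite +-suc a x = begin
    L a + (slope b + x * slope b)  ≡⟨ arith (L a) _ _ ⟩
    (L a + x * slope b) + slope b  ≤⟨ +-mono-≤ (L-+-≥ a x b (<⇒≤ a+x≤b)) (slope-antitone (s≤s⁻¹ a+x≤b)) ⟩
    L (a + x) + slope (a + x)      ∎
    where
    open ≤-Reasoning
    arith : ∀ a b c → a + (b + c) ≡ (a + c) + b
    arith = solve-∀

  L-+-≤ : ∀ a x → L (a + x) ≤ L a + x * slope a
  L-+-≤ a zero    = ≤-reflexive (trans (cong L (+-identityʳ a)) (sym (+-identityʳ _)))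
  L-+-≤ a (suc x) rewrite +-suc a x = begin
    L (a + x) + slope (a + x)      ≤⟨ +-mono-≤ (L-+-≤ a x) (slope-antitone (m≤m+n a x)) ⟩
    (L a + x * slope a) + slope a  ≡⟨ arith (L a) _ _ ⟩
    L a + (slope a + x * slope a)  ∎
    where
    open ≤-Reasoning
    arith : ∀ a b c → (a + c) + b ≡ a + (b + c)
    arith = solve-∀

  L-mono-≤ : ∀ {a b} → a ≤ b → L a ≤ L b
  L-mono-≤ {a} a≤b with m≤n⇒∃[o]m+o≡n a≤b
  ... | x , refl = ≤-trans (m≤m+n (L a) _) (L-+-≥ a x (a + x) (n≤1+n _))

  -- The division-free form of log (1 + x/a) ≥ x/(a + x), meaningful also at `a = 0`. It is the only
  -- lower bound on the growth of `L` used later.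
  L-increment : ∀ a x → (a + x) * L a + W * x ≤ (a + x) * L (a + x)
  L-increment a zero    = ≤-reflexive (trans (cong ((a + 0) * L a +_) (*-zeroʳ W))
                            (trans (+-identityʳ _) (cong (λ y → (a + 0) * L y) (sym (+-identityʳ a)))))
  L-increment a (suc x) rewrite +-suc a x = begin
    suc (a + x) * L a + W * suc x
      ≤⟨ +-monoʳ-≤ (suc (a + x) * L a) (*-monoˡ-≤ (suc x) (W≤[1+j]*slope (a + x))) ⟩
    suc (a + x) * L a + suc (a + x) * slope (a + x) * suc x  ≡⟨ arith (suc (a + x)) (L a) (slope (a + x)) (suc x) ⟩
    suc (a + x) * (L a + suc x * slope (a + x))
      ≤⟨ *-monoʳ-≤ (suc (a + x)) (L-+-≥ a (suc x) (a + x) (≤-reflexive (+-suc a x))) ⟩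
    suc (a + x) * L (a + suc x)                              ≡⟨ cong (λ y → suc (a + x) * L y) (+-suc a x) ⟩
    suc (a + x) * L (suc (a + x))                            ∎
    where
    open ≤-Reasoning
    arith : ∀ a b c d → a * b + a * c * d ≡ a * (b + d * c)
    arith = solve-∀

-- Dyadic blocks: doubling the argument from `2 ^ i` adds at most `2 ^ T` from the harmonic terms
-- and at most `2 ^ i` from rounding. With the scale `2 ^ T` and `i ≤ T`, rounding costs no more
-- than the main term.
L[2^i]≤ : ∀ T i → i ≤ T → HarmonicLog.L (2 ^ T) (2 ^ i) ≤ 2 ^ T * (2 * suc i)
L[2^i]≤ T zero    i≤T = begin
  suc (2 ^ T / 1)    ≤⟨ +-mono-≤ (m^n>0 2 T) (≤-trans (≤-reflexive (sym (*-identityʳ _))) (m/n*n≤m (2 ^ T) 1)) ⟩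
  2 ^ T + 2 ^ T      ≡⟨ double (2 ^ T) ⟩
  2 ^ T * 2          ∎
  where
  open ≤-Reasoning
  double : ∀ x → x + x ≡ x * 2
  double = solve-∀
L[2^i]≤ T (suc i) i<T = begin
  L (2 * 2 ^ i)                                  ≡⟨ cong L (cong (2 ^ i +_) (+-identityʳ (2 ^ i))) ⟩
  L (2 ^ i + 2 ^ i)                              ≤⟨ L-+-≤ (2 ^ i) (2 ^ i) ⟩
  L (2 ^ i) + 2 ^ i * slope (2 ^ i)              ≤⟨ +-mono-≤ (L[2^i]≤ T i (<⇒≤ i<T)) block ⟩
  2 ^ T * (2 * suc i) + (2 ^ T + 2 ^ T)          ≡⟨ arith (2 ^ T) i ⟩
  2 ^ T * (2 * suc (suc i))                      ∎
  where
  open HarmonicLog (2 ^ T)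
  open ≤-Reasoning
  arith : ∀ w i → w * (2 * suc i) + (w + w) ≡ w * (2 * suc (suc i))
  arith = solve-∀
  block : 2 ^ i * slope (2 ^ i) ≤ 2 ^ T + 2 ^ T
  block = begin
    2 ^ i * suc (2 ^ T / suc (2 ^ i))            ≡⟨ *-suc (2 ^ i) _ ⟩
    2 ^ i + 2 ^ i * (2 ^ T / suc (2 ^ i))        ≤⟨ +-mono-≤ (^-monoʳ-≤ 2 (<⇒≤ i<T)) (*-monoˡ-≤ _ (n≤1+n (2 ^ i))) ⟩
    2 ^ T + suc (2 ^ i) * (2 ^ T / suc (2 ^ i))  ≡⟨ cong (2 ^ T +_) (*-comm (suc (2 ^ i)) _) ⟩
    2 ^ T + 2 ^ T / suc (2 ^ i) * suc (2 ^ i)    ≤⟨ +-monoʳ-≤ (2 ^ T) (m/n*n≤m (2 ^ T) (suc (2 ^ i))) ⟩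
    2 ^ T + 2 ^ T                                ∎

-- Coloured graphs

⟦_⟧ : Bool → ℕ
⟦ false ⟧ = 0
⟦ true  ⟧ = 1

card : ∀ {N} → (Fin N → Bool) → ℕ
card X = sum (⟦_⟧ ∘ X)

_⊆ᵇ_ : ∀ {N} → (Fin N → Bool) → (Fin N → Bool) → Set
X ⊆ᵇ Y = ∀ v → X v ≡ true → Y v ≡ true

_∖_ : ∀ {N} → (Fin N → Bool) → (Fin N → Bool) → Fin N → Bool
(Y ∖ X) v = Y v ∧ not (X v)

⟦⟧-split : ∀ x y → (x ≡ true → y ≡ true) → ⟦ y ⟧ ≡ ⟦ x ⟧ + ⟦ y ∧ not x ⟧
⟦⟧-split false false _   = refl
⟦⟧-split false true  _   = refl
⟦⟧-split true  y     x⇒y rewrite x⇒y refl = refl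

card-split : ∀ {N} {X Y : Fin N → Bool} → X ⊆ᵇ Y → card Y ≡ card X + card (Y ∖ X)
card-split {X = X} {Y} X⊆Y = trans (sum-cong-≗ λ v → ⟦⟧-split (X v) (Y v) (X⊆Y v))
                                   (∑-distrib-+ (⟦_⟧ ∘ X) (⟦_⟧ ∘ (Y ∖ X)))

card-mono-≤ : ∀ {N} {X Y : Fin N → Bool} → X ⊆ᵇ Y → card X ≤ card Y
card-mono-≤ X⊆Y = ≤-trans (m≤m+n _ _) (≤-reflexive (sym (card-split X⊆Y)))

card>0⇒∃ : ∀ {N} (X : Fin N → Bool) → 1 ≤ card X → ∃ λ v → X v ≡ true
card>0⇒∃ {suc N} X 1≤ with X zero in eq
... | true  = zero , eq
... | false with card>0⇒∃ (X ∘ suc) 1≤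
...   | v , Xv = suc v , Xv

-- The hypothesis matching says that the 2n endpoints of the edges of each colour are distinct.
module Graph {N k n : ℕ} (src tgt : Fin k → Fin n → Fin N)
  (matching : ∀ c (f : Fin N → ℕ) → sum (λ a → f (src c a) + f (tgt c a)) ≤ sum f)
  where

  inner : (Fin N → Bool) → Fin k → ℕ
  inner X c = sum λ a → ⟦ X (src c a) ∧ X (tgt c a) ⟧

  edges : (Fin N → Bool) → ℕ
  edges X = sum (inner X)

  crossing : (Fin N → Bool) → (Fin N → Bool) → Fin k → ℕ
  crossing H X c = sum λ a → ⟦ (H (src c a) ∧ H (tgt c a)) ∧ (X (src c a) xor X (tgt c a)) ⟧

  boundary : (Fin N → Bool) → (Fin N → Bool) → ℕ
  boundary H X = sum (crossing H X)

  edges-cong : ∀ {X Y} → (∀ v → X v ≡ Y v) → edges X ≡ edges Y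
  edges-cong X≡Y = sum-cong-≗ λ c → sum-cong-≗ λ a →
    cong₂ (λ x y → ⟦ x ∧ y ⟧) (X≡Y (src c a)) (X≡Y (tgt c a))

  -- By `matching`, an edge inside `X` uses two different vertices of `X`, and edges of one colour
  -- share none, so each colour has at most half as many inner edges as `X` has vertices.
  edges-trivial : ∀ X → card X ≤ 1 → edges X ≡ 0
  edges-trivial X card≤1 = trans (sum-cong-≗ λ c → n<1⇒n≡0 (*-cancelˡ-< 2 _ 1 (s≤s (≤-trans (twice c) card≤1))))
                                 (trans (sum-const k 0) (*-zeroʳ k))
    where
    open ≤-Reasoning
    both : ∀ x y → 2 * ⟦ x ∧ y ⟧ ≤ ⟦ x ⟧ + ⟦ y ⟧
    both false y     = z≤n
    both true  false = z≤n
    both true  true  = ≤-refl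
    twice : ∀ c → 2 * inner X c ≤ card X
    twice c = begin
      2 * inner X c                                    ≡⟨ *-distribˡ-sum 2 (λ a → ⟦ X (src c a) ∧ X (tgt c a) ⟧) ⟩
      sum (λ a → 2 * ⟦ X (src c a) ∧ X (tgt c a) ⟧)    ≤⟨ sum-mono-≤ (λ a → both (X (src c a)) (X (tgt c a))) ⟩
      sum (λ a → ⟦ X (src c a) ⟧ + ⟦ X (tgt c a) ⟧)    ≤⟨ matching c (⟦_⟧ ∘ X) ⟩
      card X                                           ∎

  edges-split : ∀ {H X} → X ⊆ᵇ H → edges H ≡ edges X + boundary H X + edges (H ∖ X)
  edges-split {H} {X} X⊆H = begin
    edges H                                                      ≡⟨ sum-cong-≗ per-colour ⟩
    sum (λ c → inner X c + crossing H X c + inner (H ∖ X) c)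
      ≡⟨ ∑-distrib-+ (λ c → inner X c + crossing H X c) (inner (H ∖ X)) ⟩
    sum (λ c → inner X c + crossing H X c) + edges (H ∖ X)
      ≡⟨ cong (_+ edges (H ∖ X)) (∑-distrib-+ (inner X) (crossing H X)) ⟩
    edges X + boundary H X + edges (H ∖ X)                       ∎
    where
    open ≡-Reasoning
    pointwise : ∀ hs ht xs xt → (xs ≡ true → hs ≡ true) → (xt ≡ true → ht ≡ true) →
      ⟦ hs ∧ ht ⟧ ≡ ⟦ xs ∧ xt ⟧ + ⟦ (hs ∧ ht) ∧ (xs xor xt) ⟧ + ⟦ (hs ∧ not xs) ∧ (ht ∧ not xt) ⟧
    pointwise false false false false p q = refl
    pointwise false true  false false p q = refl
    pointwise true  false false false p q = refl
    pointwise true  true  false false p q = refl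
    pointwise hs    true  false true  p q with hs
    ... | false = refl
    ... | true  = refl
    pointwise hs    false false true  p q = contradiction (q refl) λ()
    pointwise true  false true  false p q = refl
    pointwise true  true  true  false p q = refl
    pointwise false ht    true  xt    p q = contradiction (p refl) λ()
    pointwise true  false true  true  p q = contradiction (q refl) λ()
    pointwise true  true  true  true  p q = refl
    per-colour : ∀ c → inner H c ≡ inner X c + crossing H X c + inner (H ∖ X) c
    per-colour c = begin
      inner H c
        ≡⟨ sum-cong-≗ (λ a → pointwise (H (src c a)) (H (tgt c a)) (X (src c a)) (X (tgt c a)) (X⊆H _) (X⊆H _)) ⟩
      sum (λ a → in-X a + across a + in-H∖X a)    ≡⟨ ∑-distrib-+ (λ a → in-X a + across a) in-H∖X ⟩
      sum (λ a → in-X a + across a) + sum in-H∖X  ≡⟨ cong (_+ sum in-H∖X) (∑-distrib-+ in-X across) ⟩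
      inner X c + crossing H X c + inner (H ∖ X) c ∎
      where
      in-X across in-H∖X : Fin n → ℕ
      in-X a   = ⟦ X (src c a) ∧ X (tgt c a) ⟧
      across a = ⟦ (H (src c a) ∧ H (tgt c a)) ∧ (X (src c a) xor X (tgt c a)) ⟧
      in-H∖X a = ⟦ (H ∖ X) (src c a) ∧ (H ∖ X) (tgt c a) ⟧

  -- Expansion of minimal dense vertex sets

  module Expansion (L : ℕ → ℕ) (L-mono-≤ : ∀ {a b} → a ≤ b → L a ≤ L b) (α β : ℕ) where

    weight : (Fin N → Bool) → ℕ
    weight X = α * (card X * L (card X))

    -- The density of edges against |X| log |X| is compared with the fixed threshold `α` / `β`,
    -- avoiding division: `H` reaches the threshold and no smaller set exceeds it.
    MinimalDense : (Fin N → Bool) → Set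
    MinimalDense H = weight H ≤ β * edges H × (∀ X → card X < card H → β * edges X ≤ weight X)

    -- Descent on cardinality: as long as some smaller set exceeds the threshold, move to it. The
    -- search runs over vectors, hence the passage through `tabulate` and `lookup`.
    minimalDense : ∀ P → 1 ≤ card P → weight P ≤ β * edges P →
      ∃ λ H → 1 ≤ card H × MinimalDense H
    minimalDense P = search P (<-wellFounded (card P))
      where
      search : ∀ P → Acc _<_ (card P) → 1 ≤ card P → weight P ≤ β * edges P →
        ∃ λ H → 1 ≤ card H × MinimalDense H
      search P (acc smaller) 1≤P dense
        with anySubset? (λ X → (card (lookup X) <? card P) ×-dec (weight (lookup X) <? β * edges (lookup X)))
      ... | yes (X , X<P , X-dense) = search (lookup X) (smaller X<P) (n≢0⇒n>0 nonempty) (<⇒≤ X-dense)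
        where
        -- Strictness of the searched inequality matters here: an empty set has no edges and cannot
        -- exceed the threshold.
        nonempty : card (lookup X) ≢ 0
        nonempty eq = contradiction
          (subst (weight (lookup X) <_)
                 (trans (cong (β *_) (edges-trivial (lookup X) (≤-trans (≤-reflexive eq) z≤n))) (*-zeroʳ β)) X-dense)
          λ()
      ... | no none = P , 1≤P , dense , λ X X<P → ≮⇒≥ λ X-dense →
        none (tabulate X ,
              subst (_< card P) (sym (card-tab X)) X<P ,
              subst₂ _<_ (cong (λ r → α * (r * L r)) (sym (card-tab X)))
                         (cong (β *_) (sym (edges-cong (lookup∘tabulate X)))) X-dense)
        where
        card-tab : ∀ X → card (lookup (tabulate X)) ≡ card X
        card-tab X = sum-cong-≗ λ v → cong ⟦_⟧ (lookup∘tabulate X v)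

    -- Read as α |X| (L |H| - L |X|) ≤ β times the boundary. Each edge of `H` lies in `X`, in the
    -- rest of `H`, or across; both parts are sparse by minimality, and the weight of the rest,
    -- bounded through `L (card H)`, cancels. Minimality speaks only of strictly smaller sets, so
    -- `X` empty and `X` equal to `H` are treated apart.
    expansion : ∀ {H X} → MinimalDense H → X ⊆ᵇ H →
      α * (card X * L (card H)) ≤ β * boundary H X + weight X
    expansion {H} {X} (H-dense , sparse) X⊆H with card X ≟ 0 | card (H ∖ X) ≟ 0
    ... | yes X≡0 | _ rewrite X≡0 | *-zeroʳ α = z≤n
    ... | no _ | yes Y≡0 = ≤-trans (≤-reflexive (cong (λ h → α * (card X * L h)) H≡X)) (m≤n+m (weight X) _)
      where
      H≡X : card H ≡ card X
      H≡X = trans (card-split X⊆H) (trans (cong (card X +_) Y≡0) (+-identityʳ _))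
    ... | no X≢0 | no Y≢0 = +-cancelʳ-≤ (α * (y * L h)) _ _ (begin
      α * (x * L h) + α * (y * L h)                ≡⟨ collect α x y (L h) ⟩
      α * ((x + y) * L h)                          ≡⟨ cong (λ z → α * (z * L h)) (card-split X⊆H) ⟨
      weight H                                     ≤⟨ H-dense ⟩
      β * edges H                                  ≡⟨ cong (β *_) (edges-split X⊆H) ⟩
      β * (edges X + boundary H X + edges (H ∖ X)) ≡⟨ distribute β (edges X) (boundary H X) (edges (H ∖ X)) ⟩
      β * boundary H X + β * edges X + β * edges (H ∖ X)
        ≤⟨ +-mono-≤ (+-monoʳ-≤ (β * boundary H X) (sparse X X<H))
                    (≤-trans (sparse (H ∖ X) Y<H) (*-monoʳ-≤ α (*-monoʳ-≤ y (L-mono-≤ (<⇒≤ Y<H))))) ⟩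
      β * boundary H X + weight X + α * (y * L h)  ∎)
      where
      open ≤-Reasoning
      x y h : ℕ
      x = card X
      y = card (H ∖ X)
      h = card H
      X<H : x < h
      X<H = <-≤-trans (m<m+n x (n≢0⇒n>0 Y≢0)) (≤-reflexive (sym (card-split X⊆H)))
      Y<H : y < h
      Y<H = <-≤-trans (m<n+m y (n≢0⇒n>0 X≢0)) (≤-reflexive (sym (card-split X⊆H)))
      collect : ∀ a x y l → a * (x * l) + a * (y * l) ≡ a * ((x + y) * l)
      collect = solve-∀
      distribute : ∀ b x z y → b * (x + z + y) ≡ b * z + b * x + b * y
      distribute = solve-∀

-- Rainbow walks

∣p[x]≔inside∣≡1+∣p[x]≔outside∣ : ∀ {m} (p : Subset m) x → ∣ p [ x ]≔ inside ∣ ≡ suc ∣ p [ x ]≔ outside ∣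
∣p[x]≔inside∣≡1+∣p[x]≔outside∣ (b       ∷ p) zero    = refl
∣p[x]≔inside∣≡1+∣p[x]≔outside∣ (inside  ∷ p) (suc x) = cong suc (∣p[x]≔inside∣≡1+∣p[x]≔outside∣ p x)
∣p[x]≔inside∣≡1+∣p[x]≔outside∣ (outside ∷ p) (suc x) = ∣p[x]≔inside∣≡1+∣p[x]≔outside∣ p x

sum-indicator : ∀ {N} (v : Fin N) → sum (λ u → ⟦ does (u Fin.≟ v) ⟧) ≡ 1
sum-indicator {suc N} zero    = cong suc (trans (sum-const N 0) (*-zeroʳ N))
sum-indicator {suc N} (suc v) = sum-indicator v

module Rainbow {N k n : ℕ} (src tgt : Fin k → Fin n → Fin N)
  (matching : ∀ c (f : Fin N → ℕ) → sum (λ a → f (src c a) + f (tgt c a)) ≤ sum f)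
  where

  open Graph src tgt matching

  -- The Boolean records whether an edge is traversed from `src` to `tgt`, so that the label list of
  -- a walk is a signed word in the format of `evalWord`.
  data Walk : Fin N → List (Fin k × Bool) → Fin N → Set where
    []       : ∀ {u} → Walk u [] u
    forward  : ∀ {c a w v} → Walk (tgt c a) w v → Walk (src c a) ((c , true) ∷ w) v
    backward : ∀ {c a w v} → Walk (src c a) w v → Walk (tgt c a) ((c , false) ∷ w) v

  colours : List (Fin k × Bool) → List (Fin k)
  colours = map proj₁

  -- The formal inverse of the first word followed by the second, in accumulator form. It joins two
  -- walks with a common start into one walk between their ends.
  flipOnto : List (Fin k × Bool) → List (Fin k × Bool) → List (Fin k × Bool)
  flipOnto []            w′ = w′
  flipOnto ((c , b) ∷ w) w′ = flipOnto w ((c , not b) ∷ w′)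

  flipOnto-walk : ∀ {u v z w w′} → Walk u w v → Walk u w′ z → Walk v (flipOnto w w′) z
  flipOnto-walk []           q = q
  flipOnto-walk (forward p)  q = flipOnto-walk p (backward q)
  flipOnto-walk (backward p) q = flipOnto-walk p (forward q)

  flipOnto-unique : ∀ w w′ → Unique (colours w) → Unique (colours w′) →
    All (λ c → All (c ≢_) (colours w′)) (colours w) → Unique (colours (flipOnto w w′))
  flipOnto-unique []            w′ _           w′! _                  = w′!
  flipOnto-unique ((c , b) ∷ w) w′ (c∉w ∷ w!) w′! (c∉w′ ∷ disjoint) =
    flipOnto-unique w ((c , not b) ∷ w′) w! (c∉w′ ∷ w′!)
      (All.zipWith (λ (c≢d , d∉w′) → ≢-sym c≢d ∷ d∉w′) (c∉w , disjoint))

  flipOnto-nonempty : ∀ w x w′ → flipOnto w (x ∷ w′) ≢ []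
  flipOnto-nonempty (y ∷ w) x w′ = flipOnto-nonempty w _ (x ∷ w′)

  flipOnto-[]ʳ : ∀ w w′ → flipOnto w w′ ≡ [] → w ≡ []
  flipOnto-[]ʳ []            w′ _  = refl
  flipOnto-[]ʳ ((c , b) ∷ w) w′ eq = contradiction eq (flipOnto-nonempty w (c , not b) w′)

  NoRainbowCycle : Set
  NoRainbowCycle = ∀ v w → Unique (colours w) → Walk v w v → w ≡ []

  module Reachability (H : Fin N → Bool) (root : Fin N) where

    -- The number bounds the length of the walk, which makes the recursion structural and the
    -- predicate decidable. The edge split off is the one at `u`; the rest of the walk to `root` has
    -- to avoid its colour.
    Reach : ℕ → Subset k → Fin N → Set
    Reach zero    C u = u ≡ root
    Reach (suc f) C u = Reach f C u ⊎ ∃₂ λ c a →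
      lookup C c ≡ inside × (H (src c a) ≡ true × H (tgt c a) ≡ true) ×
      (u ≡ src c a × Reach f (C [ c ]≔ outside) (tgt c a) ⊎
       u ≡ tgt c a × Reach f (C [ c ]≔ outside) (src c a))

    reach? : ∀ f C u → Dec (Reach f C u)
    reach? zero    C u = u Fin.≟ root
    reach? (suc f) C u = reach? f C u ⊎-dec Fin.any? λ c → Fin.any? λ a →
      (lookup C c Bool.≟ inside) ×-dec ((H (src c a) Bool.≟ true) ×-dec (H (tgt c a) Bool.≟ true)) ×-dec
      (((u Fin.≟ src c a) ×-dec reach? f (C [ c ]≔ outside) (tgt c a)) ⊎-dec
       ((u Fin.≟ tgt c a) ×-dec reach? f (C [ c ]≔ outside) (src c a)))

    -- Reach removes a colour from C once it is used, so ∣ C ∣ steps exhaust the rainbow walks.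
    reached : Subset k → Fin N → Bool
    reached C u = does (reach? ∣ C ∣ C u)

    reached⁺ : ∀ {C u} → Reach ∣ C ∣ C u → reached C u ≡ true
    reached⁺ {C} {u} = dec-true (reach? ∣ C ∣ C u)

    reached⁻ : ∀ {C u} → reached C u ≡ true → Reach ∣ C ∣ C u
    reached⁻ {C} {u} eq with reach? ∣ C ∣ C u
    ... | yes r = r

    _⊑_ : Subset k → Subset k → Set
    C ⊑ D = ∀ c → lookup C c ≡ inside → lookup D c ≡ inside

    remove-⊑ : ∀ (C : Subset k) c d → lookup (C [ c ]≔ outside) d ≡ inside → c ≢ d × lookup C d ≡ inside
    remove-⊑ C c d eq with c Fin.≟ d
    ... | yes refl = contradiction (trans (sym (lookup∘updateAt c {λ _ → outside} C)) eq) λ()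
    ... | no c≢d   = c≢d , trans (sym (lookup∘updateAt′ d c (≢-sym c≢d) C)) eq

    ⊑-remove : ∀ (C D : Subset k) c → C ⊑ D → (C [ c ]≔ outside) ⊑ (D [ c ]≔ outside)
    ⊑-remove C D c C⊑D d eq with remove-⊑ C c d eq
    ... | c≢d , Cd = trans (lookup∘updateAt′ d c (≢-sym c≢d) D) (C⊑D d Cd)

    remove-⊑-add : ∀ (C : Subset k) c → (C [ c ]≔ outside) ⊑ (C [ c ]≔ inside)
    remove-⊑-add C c d eq with remove-⊑ C c d eq
    ... | c≢d , Cd = trans (lookup∘updateAt′ d c (≢-sym c≢d) C) Cd

    reach-mono : ∀ f {C D u} → C ⊑ D → Reach f C u → Reach f D u
    reach-mono zero    C⊑D r = r
    reach-mono (suc f) C⊑D (inj₁ r) = inj₁ (reach-mono f C⊑D r)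
    reach-mono (suc f) {C} {D} C⊑D (inj₂ (c , a , Cc , Ha , inj₁ (eq , r))) =
      inj₂ (c , a , C⊑D c Cc , Ha , inj₁ (eq , reach-mono f (⊑-remove C D c C⊑D) r))
    reach-mono (suc f) {C} {D} C⊑D (inj₂ (c , a , Cc , Ha , inj₂ (eq , r))) =
      inj₂ (c , a , C⊑D c Cc , Ha , inj₂ (eq , reach-mono f (⊑-remove C D c C⊑D) r))

    module _ (C : Subset k) (c : Fin k) where

      private
        C⁻ C⁺ : Subset k
        C⁻ = C [ c ]≔ outside
        C⁺ = C [ c ]≔ inside

        -- `C⁺` has exactly one colour more than `C⁻`, so its step bound leaves room for one extra
        -- edge of colour `c`.
        reach⁺ : ∀ {u} → Reach (suc ∣ C⁻ ∣) C⁺ u → reached C⁺ u ≡ true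
        reach⁺ {u} r = reached⁺ (subst (λ f → Reach f C⁺ u) (sym (∣p[x]≔inside∣≡1+∣p[x]≔outside∣ C c)) r)

        shrink : ∀ {u} → Reach ∣ C⁻ ∣ C⁻ u → Reach ∣ C⁻ ∣ (C⁺ [ c ]≔ outside) u
        shrink {u} = subst (λ D → Reach ∣ C⁻ ∣ D u) (sym ([]≔-idempotent C c))

      reached-grow : reached C⁻ ⊆ᵇ reached C⁺
      reached-grow u r = reach⁺ (inj₁ (reach-mono ∣ C⁻ ∣ (remove-⊑-add C c) (reached⁻ {C⁻} r)))

      reached-forward : ∀ a → H (src c a) ≡ true → H (tgt c a) ≡ true →
        reached C⁻ (src c a) ≡ true → reached C⁺ (tgt c a) ≡ true
      reached-forward a Hs Ht r =
        reach⁺ (inj₂ (c , a , lookup∘updateAt c C , (Hs , Ht) , inj₂ (refl , shrink (reached⁻ {C⁻} r))))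

      reached-backward : ∀ a → H (src c a) ≡ true → H (tgt c a) ≡ true →
        reached C⁻ (tgt c a) ≡ true → reached C⁺ (src c a) ≡ true
      reached-backward a Hs Ht r =
        reach⁺ (inj₂ (c , a , lookup∘updateAt c C , (Hs , Ht) , inj₁ (refl , shrink (reached⁻ {C⁻} r))))

    reach-root : ∀ f C → Reach f C root
    reach-root zero    C = refl
    reach-root (suc f) C = inj₁ (reach-root f C)

    reach-⊆ : H root ≡ true → ∀ f C u → Reach f C u → H u ≡ true
    reach-⊆ Hr zero    C u refl     = Hr
    reach-⊆ Hr (suc f) C u (inj₁ r) = reach-⊆ Hr f C u r
    reach-⊆ Hr (suc f) C u (inj₂ (c , a , _ , (Hs , Ht) , inj₁ (refl , _))) = Hs
    reach-⊆ Hr (suc f) C u (inj₂ (c , a , _ , (Hs , Ht) , inj₂ (refl , _))) = Ht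

    reach-walk : ∀ f C u → Reach f C u →
      ∃ λ w → Walk u w root × Unique (colours w) × All (λ c → lookup C c ≡ inside) (colours w)
    reach-walk zero    C u refl     = [] , [] , [] , []
    reach-walk (suc f) C u (inj₁ r) = reach-walk f C u r
    reach-walk (suc f) C u (inj₂ (c , a , Cc , _ , inj₁ (refl , r)))
      with reach-walk f (C [ c ]≔ outside) (tgt c a) r
    ... | w , p , w! , w⊆ = _ , forward p , All.map (λ {d} → proj₁ ∘ remove-⊑ C c d) w⊆ ∷ w!
                                          , Cc ∷ All.map (λ {d} → proj₂ ∘ remove-⊑ C c d) w⊆
    reach-walk (suc f) C u (inj₂ (c , a , Cc , _ , inj₂ (refl , r)))
      with reach-walk f (C [ c ]≔ outside) (src c a) r
    ... | w , p , w! , w⊆ = _ , backward p , All.map (λ {d} → proj₁ ∘ remove-⊑ C c d) w⊆ ∷ w!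
                                           , Cc ∷ All.map (λ {d} → proj₂ ∘ remove-⊑ C c d) w⊆

    -- The two walks from `u` to `root` use disjoint sets of colours, so reversing one and
    -- continuing along the other is a rainbow closed walk at `root`. It must be empty, whence `u`
    -- is `root`.
    reach-disjoint : NoRainbowCycle → ∀ f f′ C u → Reach f C u → Reach f′ (∁ C) u → u ≡ root
    reach-disjoint acyclic f f′ C u r r′
      with reach-walk f C u r | reach-walk f′ (∁ C) u r′
    ... | w , p , w! , w⊆ | w′ , p′ , w′! , w′⊆ = trivial w p (flipOnto-[]ʳ w w′
        (acyclic root (flipOnto w w′) (flipOnto-unique w w′ w! w′! disjoint) (flipOnto-walk p p′)))
      where
      trivial : ∀ w → Walk u w root → w ≡ [] → u ≡ root
      trivial [] [] refl = refl
      separate : ∀ c d → lookup C c ≡ inside → lookup (∁ C) d ≡ inside → c ≢ d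
      separate c _ Cc ∁Cd refl = contradiction (trans (sym ∁Cd) (trans (lookup-map c not C) (cong not Cc))) λ()
      disjoint : All (λ c → All (c ≢_) (colours w′)) (colours w)
      disjoint = All.map (λ {c} Cc → All.map (λ {d} → separate c d Cc) w′⊆) w⊆

-- Growth of the set reached by rainbow walks

module RainbowBound {N k n : ℕ} (src tgt : Fin k → Fin n → Fin N)
  (matching : ∀ c (f : Fin N → ℕ) → sum (λ a → f (src c a) + f (tgt c a)) ≤ sum f)
  (W : ℕ) (L : ℕ → ℕ)
  (L-mono-≤ : ∀ {a b} → a ≤ b → L a ≤ L b)
  (L-increment : ∀ a x → (a + x) * L a + W * x ≤ (a + x) * L (a + x))
  where

  open Graph src tgt matching
  open Rainbow src tgt matching

  -- In the application `p`, `q`, `r` are the sizes reached from `C⁻`, `C⁺`, `C`, and `x` counts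
  -- crossing edges. `L-increment` yields the denominator `p + x` or `q`: the first is at most
  -- `2 * r` if `r` is `p`, since `x ≤ r`, and the second is `r` itself if `r` is `q`.
  2r*L-increment : ∀ {p x q r} → p + x ≤ q → x ≤ r → r ≡ p ⊎ r ≡ q →
    2 * r * L p + W * x ≤ 2 * r * L q
  2r*L-increment {p} {x} {q} p+x≤q x≤r (inj₁ refl) with m≤n⇒∃[o]m+o≡n x≤r
  ... | e , refl = begin
    2 * p * L p + W * x                        ≡⟨ split x e (L p) (W * x) ⟩
    ((p + x) * L p + W * x) + e * L p          ≤⟨ +-mono-≤ (L-increment p x) (*-monoʳ-≤ e (L-mono-≤ (m≤m+n p x))) ⟩
    (p + x) * L (p + x) + e * L (p + x)        ≡⟨ merge x e (L (p + x)) ⟩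
    2 * p * L (p + x)                          ≤⟨ *-monoʳ-≤ (2 * p) (L-mono-≤ p+x≤q) ⟩
    2 * p * L q                                ∎
    where
    open ≤-Reasoning
    split : ∀ x e l y → 2 * (x + e) * l + y ≡ ((x + e + x) * l + y) + e * l
    split = solve-∀
    merge : ∀ x e l → (x + e + x) * l + e * l ≡ 2 * (x + e) * l
    merge = solve-∀
  2r*L-increment {p} {x} {q} p+x≤q x≤r (inj₂ refl) with m≤n⇒∃[o]m+o≡n (≤-trans (m≤m+n p x) p+x≤q)
  ... | y , refl = begin
    2 * q * L p + W * x                ≤⟨ +-monoʳ-≤ (2 * q * L p) (*-monoʳ-≤ W (+-cancelˡ-≤ p x y p+x≤q)) ⟩
    2 * q * L p + W * y                ≡⟨ split q (L p) (W * y) ⟩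
    q * L p + (q * L p + W * y)        ≤⟨ +-mono-≤ (*-monoʳ-≤ q (L-mono-≤ (m≤m+n p y))) (L-increment p y) ⟩
    q * L q + q * L q                  ≡⟨ merge q (L q) ⟩
    2 * q * L q                        ∎
    where
    open ≤-Reasoning
    split : ∀ q l y → 2 * q * l + y ≡ q * l + (q * l + y)
    split = solve-∀
    merge : ∀ q l → q * l + q * l ≡ 2 * q * l
    merge = solve-∀

  module _ (H : Fin N → Bool) (root : Fin N) (root∈H : H root ≡ true) where

    open Reachability H root

    h : ℕ
    h = card H

    size : Subset k → ℕ
    size C = card (reached C)

    gap : Subset k → ℕ
    gap C = L h ∸ L (size C)

    reached-⊆ : ∀ C → reached C ⊆ᵇ H
    reached-⊆ C u r = reach-⊆ root∈H ∣ C ∣ C u (reached⁻ {C} r)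

    size≤h : ∀ C → size C ≤ h
    size≤h C = card-mono-≤ (reached-⊆ C)

    gap+L≡ : ∀ C → gap C + L (size C) ≡ L h
    gap+L≡ C = m∸n+n≡m (L-mono-≤ (size≤h C))

    size>0 : ∀ C → 1 ≤ size C
    size>0 C = ≤-trans (≤-reflexive (cong ⟦_⟧ (sym (reached⁺ {C} (reach-root ∣ C ∣ C))))) (≤-sum (⟦_⟧ ∘ reached C) root)

    module _ (C : Subset k) (c : Fin k) where

      C⁻ C⁺ : Subset k
      C⁻ = C [ c ]≔ outside
      C⁺ = C [ c ]≔ inside

      either : C ≡ C⁻ ⊎ C ≡ C⁺
      either with lookup C c in eq
      ... | false = inj₁ (trans (sym ([]≔-lookup C c)) (cong (C [ c ]≔_) eq))
      ... | true  = inj₂ (trans (sym ([]≔-lookup C c)) (cong (C [ c ]≔_) eq))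

      new : Fin N → Bool
      new = reached C⁺ ∖ reached C⁻

      -- Appending an edge of colour c to a walk avoiding c gives a walk using c at most once.  So the outer end
      -- of an edge crossing reached C⁻, and the inner end of an edge crossing reached C⁺, is a new vertex.
      crossing≤new : crossing H (reached C) c ≤ card new
      crossing≤new = ≤-trans (sum-mono-≤ λ a → by-cases either a) (matching c (⟦_⟧ ∘ new))
        where
        outer : ∀ hs ht ms mt ps pt → (hs ≡ true → ht ≡ true → ms ≡ true → pt ≡ true) →
          (hs ≡ true → ht ≡ true → mt ≡ true → ps ≡ true) →
          ⟦ (hs ∧ ht) ∧ (ms xor mt) ⟧ ≤ ⟦ ps ∧ not ms ⟧ + ⟦ pt ∧ not mt ⟧
        outer false ht    ms    mt    ps pt _ _ = z≤n
        outer true  false ms    mt    ps pt _ _ = z≤n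
        outer true  true  false false ps pt _ _ = z≤n
        outer true  true  true  true  ps pt _ _ = z≤n
        outer true  true  true  false ps pt f _ rewrite f refl refl refl = m≤n+m 1 _
        outer true  true  false true  ps pt _ b rewrite b refl refl refl = s≤s z≤n
        inner-end : ∀ hs ht ms mt ps pt → (hs ≡ true → ht ≡ true → ms ≡ true → pt ≡ true) →
          (hs ≡ true → ht ≡ true → mt ≡ true → ps ≡ true) →
          ⟦ (hs ∧ ht) ∧ (ps xor pt) ⟧ ≤ ⟦ ps ∧ not ms ⟧ + ⟦ pt ∧ not mt ⟧
        inner-end false ht    ms    mt    ps    pt    _ _ = z≤n
        inner-end true  false ms    mt    ps    pt    _ _ = z≤n
        inner-end true  true  ms    mt    false false _ _ = z≤n
        inner-end true  true  ms    mt    true  true  _ _ = z≤n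
        inner-end true  true  false mt    true  false f _ = s≤s z≤n
        inner-end true  true  true  mt    true  false f _ = contradiction (f refl refl refl) λ()
        inner-end true  true  ms    false false true  _ b = ≤-refl
        inner-end true  true  ms    true  false true  _ b = contradiction (b refl refl refl) λ()
        cut : Subset k → Fin n → ℕ
        cut D a = ⟦ (H (src c a) ∧ H (tgt c a)) ∧ (reached D (src c a) xor reached D (tgt c a)) ⟧
        gain : Fin n → ℕ
        gain a = ⟦ new (src c a) ⟧ + ⟦ new (tgt c a) ⟧
        by-cases : C ≡ C⁻ ⊎ C ≡ C⁺ → ∀ a → cut C a ≤ gain a
        by-cases (inj₁ eq) a = subst (λ D → cut D a ≤ gain a) (sym eq)
          (outer (H (src c a)) (H (tgt c a))
                 (reached C⁻ (src c a)) (reached C⁻ (tgt c a)) (reached C⁺ (src c a)) (reached C⁺ (tgt c a))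
                 (reached-forward C c a) (reached-backward C c a))
        by-cases (inj₂ eq) a = subst (λ D → cut D a ≤ gain a) (sym eq)
          (inner-end (H (src c a)) (H (tgt c a))
                     (reached C⁻ (src c a)) (reached C⁻ (tgt c a)) (reached C⁺ (src c a)) (reached C⁺ (tgt c a))
                     (reached-forward C c a) (reached-backward C c a))

      -- Each crossing edge has an end in `reached C`, and edges of one colour share no ends.
      crossing≤size : crossing H (reached C) c ≤ size C
      crossing≤size = ≤-trans (sum-mono-≤ λ a → bound (H (src c a) ∧ H (tgt c a)) (reached C (src c a)) _)
                              (matching c (⟦_⟧ ∘ reached C))
        where
        bound : ∀ e x y → ⟦ e ∧ (x xor y) ⟧ ≤ ⟦ x ⟧ + ⟦ y ⟧
        bound false x     y     = z≤n
        bound true  false y     = ≤-refl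
        bound true  true  true  = z≤n
        bound true  true  false = ≤-refl

      -- As `gap` and `L` of the size always add up to `L h`, the drop of the gap from `C⁻` to `C⁺`
      -- is the rise of `L`, which `2r*L-increment` bounds below.
      gap-colour : 2 * size C * gap C⁺ + W * crossing H (reached C) c ≤ 2 * size C * gap C⁻
      gap-colour = +-cancelʳ-≤ (2 * r * L (size C⁻)) _ _ (begin
        (2 * r * gap C⁺ + W * x) + 2 * r * L (size C⁻)  ≡⟨ swap (2 * r * gap C⁺) (W * x) _ ⟩
        2 * r * gap C⁺ + (2 * r * L (size C⁻) + W * x)
          ≤⟨ +-monoʳ-≤ (2 * r * gap C⁺) (2r*L-increment grows crossing≤size r-either) ⟩
        2 * r * gap C⁺ + 2 * r * L (size C⁺)            ≡⟨ *-distribˡ-+ (2 * r) (gap C⁺) _ ⟨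
        2 * r * (gap C⁺ + L (size C⁺))                  ≡⟨ cong (2 * r *_) (trans (gap+L≡ C⁺) (sym (gap+L≡ C⁻))) ⟩
        2 * r * (gap C⁻ + L (size C⁻))                  ≡⟨ *-distribˡ-+ (2 * r) (gap C⁻) _ ⟩
        2 * r * gap C⁻ + 2 * r * L (size C⁻)            ∎)
        where
        open ≤-Reasoning
        r x : ℕ
        r = size C
        x = crossing H (reached C) c
        grows : size C⁻ + x ≤ size C⁺
        grows = ≤-trans (+-monoʳ-≤ (size C⁻) crossing≤new) (≤-reflexive (sym (card-split (reached-grow C c))))
        r-either : r ≡ size C⁻ ⊎ r ≡ size C⁺
        r-either with either
        ... | inj₁ eq = inj₁ (cong size eq)
        ... | inj₂ eq = inj₂ (cong size eq)
        swap : ∀ a b c → (a + b) + c ≡ a + (c + b)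
        swap = solve-∀

      gap-antitone : gap C⁺ ≤ gap C
      gap-antitone with either
      ... | inj₂ eq = ≤-reflexive (cong gap (sym eq))
      ... | inj₁ eq = ∸-monoʳ-≤ (L h) (L-mono-≤ (subst (λ D → size D ≤ size C⁺) (sym eq) (card-mono-≤ (reached-grow C c))))

    gap-boundary : ∀ C → 2 * size C * up gap C + W * boundary H (reached C) ≤ 2 * size C * down gap C
    gap-boundary C = begin
      2 * r * up gap C + W * boundary H (reached C)
        ≡⟨ cong₂ _+_ (*-distribˡ-sum (2 * r) gap⁺) (*-distribˡ-sum W cross) ⟩
      sum (λ c → 2 * r * gap⁺ c) + sum (λ c → W * cross c)   ≡⟨ ∑-distrib-+ (λ c → 2 * r * gap⁺ c) (λ c → W * cross c) ⟨
      sum (λ c → 2 * r * gap⁺ c + W * cross c)               ≤⟨ sum-mono-≤ (gap-colour C) ⟩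
      sum (λ c → 2 * r * gap⁻ c)                             ≡⟨ *-distribˡ-sum (2 * r) gap⁻ ⟨
      2 * r * down gap C                                     ∎
      where
      open ≤-Reasoning
      r : ℕ
      r = size C
      gap⁺ gap⁻ cross : Fin k → ℕ
      gap⁺ c = gap (C [ c ]≔ inside)
      gap⁻ c = gap (C [ c ]≔ outside)
      cross  = crossing H (reached C)

    -- The sets reached by `C` and `∁ C` meet only in `root`, so together they miss at least h - 1 ≥
    -- h/2 vertices, counted with multiplicity. By `L-increment`, missing `y` vertices forces a gap
    -- of at least W y / h.
    gap-pair : NoRainbowCycle → 2 ≤ h → ∀ C → W ≤ 2 * (gap C + gap (∁ C))
    gap-pair acyclic 2≤h C = *-cancelˡ-≤ h {{>-nonZero (≤-trans (s≤s z≤n) 2≤h)}} (begin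
      h * W                                           ≤⟨ *-monoˡ-≤ W half ⟩
      2 * ((h ∸ r) + (h ∸ r′)) * W                    ≡⟨ distribute (h ∸ r) (h ∸ r′) W ⟩
      2 * (W * (h ∸ r) + W * (h ∸ r′))                ≤⟨ *-monoʳ-≤ 2 (+-mono-≤ (missing C) (missing (∁ C))) ⟩
      2 * (h * gap C + h * gap (∁ C))                 ≡⟨ collect h (gap C) (gap (∁ C)) ⟩
      h * (2 * (gap C + gap (∁ C)))                   ∎)
      where
      open ≤-Reasoning
      r r′ : ℕ
      r  = size C
      r′ = size (∁ C)
      distribute : ∀ a b w → 2 * (a + b) * w ≡ 2 * (w * a + w * b)
      distribute = solve-∀
      collect : ∀ h a b → 2 * (h * a + h * b) ≡ h * (2 * (a + b))
      collect = solve-∀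
      missing : ∀ D → W * (h ∸ size D) ≤ h * gap D
      missing D = +-cancelˡ-≤ (h * L (size D)) _ _ (begin
        h * L (size D) + W * (h ∸ size D)
          ≤⟨ subst (λ y → y * L (size D) + W * (h ∸ size D) ≤ y * L y) (m+[n∸m]≡n (size≤h D))
                   (L-increment (size D) (h ∸ size D)) ⟩
        h * L h                                       ≡⟨ cong (h *_) (gap+L≡ D) ⟨
        h * (gap D + L (size D))                      ≡⟨ *-distribˡ-+ h (gap D) _ ⟩
        h * gap D + h * L (size D)                    ≡⟨ +-comm (h * gap D) _ ⟩
        h * L (size D) + h * gap D                    ∎)
      shared : ∀ u → ⟦ reached C u ⟧ + ⟦ reached (∁ C) u ⟧ ≤ ⟦ H u ⟧ + ⟦ does (u Fin.≟ root) ⟧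
      shared u with reached C u in eq | reached (∁ C) u in eq′
      ... | false | false = z≤n
      ... | true  | false = ≤-trans (≤-reflexive (cong ⟦_⟧ (sym (reached-⊆ C u eq)))) (m≤m+n _ _)
      ... | false | true  = ≤-trans (≤-reflexive (cong ⟦_⟧ (sym (reached-⊆ (∁ C) u eq′)))) (m≤m+n _ _)
      ... | true  | true  = ≤-reflexive (sym (cong₂ (λ x y → ⟦ x ⟧ + ⟦ y ⟧) (reached-⊆ C u eq)
              (dec-true (u Fin.≟ root) (reach-disjoint acyclic ∣ C ∣ ∣ ∁ C ∣ C u (reached⁻ {C} eq) (reached⁻ {∁ C} eq′)))))
      r+r′≤h+1 : r + r′ ≤ h + 1
      r+r′≤h+1 = begin
        r + r′                                                      ≡⟨ ∑-distrib-+ (⟦_⟧ ∘ reached C) (⟦_⟧ ∘ reached (∁ C)) ⟨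
        sum (λ u → ⟦ reached C u ⟧ + ⟦ reached (∁ C) u ⟧)           ≤⟨ sum-mono-≤ shared ⟩
        sum (λ u → ⟦ H u ⟧ + ⟦ does (u Fin.≟ root) ⟧)               ≡⟨ ∑-distrib-+ (⟦_⟧ ∘ H) (λ u → ⟦ does (u Fin.≟ root) ⟧) ⟩
        h + sum (λ u → ⟦ does (u Fin.≟ root) ⟧)                     ≡⟨ cong (h +_) (sum-indicator root) ⟩
        h + 1                                                       ∎
      half : h ≤ 2 * ((h ∸ r) + (h ∸ r′))
      half = +-cancelʳ-≤ (2 * (r + r′) + 2) _ _ (begin
        h + (2 * (r + r′) + 2)                          ≤⟨ +-monoʳ-≤ h (+-mono-≤ (*-monoʳ-≤ 2 r+r′≤h+1) ≤-refl) ⟩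
        h + (2 * (h + 1) + 2)                           ≡⟨ arith₁ h ⟩
        3 * h + 2 + 2                                   ≤⟨ +-monoˡ-≤ 2 (+-monoʳ-≤ (3 * h) 2≤h) ⟩
        3 * h + h + 2                                   ≡⟨ arith₂ h ⟩
        2 * (h + h) + 2
          ≡⟨ cong₂ (λ x y → 2 * (x + y) + 2) (m∸n+n≡m (size≤h C)) (m∸n+n≡m (size≤h (∁ C))) ⟨
        2 * ((h ∸ r + r) + (h ∸ r′ + r′)) + 2           ≡⟨ arith₃ (h ∸ r) r (h ∸ r′) r′ ⟩
        2 * ((h ∸ r) + (h ∸ r′)) + (2 * (r + r′) + 2)   ∎)
        where
        arith₁ : ∀ h → h + (2 * (h + 1) + 2) ≡ 3 * h + 2 + 2
        arith₁ = solve-∀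
        arith₂ : ∀ h → 3 * h + h + 2 ≡ 2 * (h + h) + 2
        arith₂ = solve-∀
        arith₃ : ∀ a b c d → 2 * ((a + b) + (c + d)) + 2 ≡ 2 * (a + c) + (2 * (b + d) + 2)
        arith₃ = solve-∀

    module _ (B : ℕ) where

      open Expansion L L-mono-≤ k (B * W)

      -- Expansion gives k |R C| gap C ≤ B W times the boundary of R C, and `gap-boundary` bounds W
      -- times that boundary by 2 |R C| times the drop from `down gap C` to `up gap C`. The size of
      -- R C cancels.
      gap-contraction : MinimalDense H → ∀ C → 2 * B * up gap C + k * gap C ≤ 2 * B * down gap C
      gap-contraction H-minimal C = *-cancelˡ-≤ r {{>-nonZero (size>0 C)}} (begin
        r * (2 * B * up gap C + k * gap C)                     ≡⟨ expand r B (up gap C) k (gap C) ⟩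
        B * (2 * r * up gap C) + k * (r * gap C)               ≤⟨ +-monoʳ-≤ (B * (2 * r * up gap C)) expands ⟩
        B * (2 * r * up gap C) + B * W * ∂                     ≡⟨ factor B (2 * r * up gap C) W ∂ ⟩
        B * (2 * r * up gap C + W * ∂)                         ≤⟨ *-monoʳ-≤ B (gap-boundary C) ⟩
        B * (2 * r * down gap C)                               ≡⟨ rotate B r (down gap C) ⟩
        r * (2 * B * down gap C)                               ∎)
        where
        open ≤-Reasoning
        r ∂ : ℕ
        r = size C
        ∂ = boundary H (reached C)
        expand : ∀ r b u k g → r * (2 * b * u + k * g) ≡ b * (2 * r * u) + k * (r * g)
        expand = solve-∀
        factor : ∀ b u w d → b * u + b * w * d ≡ b * (u + w * d)
        factor = solve-∀
        rotate : ∀ b r d → b * (2 * r * d) ≡ r * (2 * b * d)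
        rotate = solve-∀
        distribute : ∀ k r g l → k * (r * (g + l)) ≡ k * (r * g) + k * (r * l)
        distribute = solve-∀
        expands : k * (r * gap C) ≤ B * W * ∂
        expands = +-cancelʳ-≤ (k * (r * L r)) _ _ (begin
          k * (r * gap C) + k * (r * L r)                      ≡⟨ distribute k r (gap C) (L r) ⟨
          k * (r * (gap C + L r))                              ≡⟨ cong (λ y → k * (r * y)) (gap+L≡ C) ⟩
          k * (r * L h)                                        ≤⟨ expansion H-minimal (reached-⊆ C) ⟩
          B * W * ∂ + k * (r * L r)                            ∎)

  module _ (B τ : ℕ) .{{_ : NonZero B}} .{{_ : NonZero W}} .{{_ : NonZero k}} (1≤N : 1 ≤ N)
    (LN≤ : L N ≤ W * τ) (dense : k * (N * L N) ≤ B * W * (k * n)) (acyclic : NoRainbowCycle)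
    where

    open Expansion L L-mono-≤ k (B * W)

    private
      all : Fin N → Bool
      all _ = true

      card-all : card all ≡ N
      card-all = trans (sum-const N 1) (*-identityʳ N)

      edges-all : edges all ≡ k * n
      edges-all = trans (sum-cong-≗ {k} {inner all} {λ _ → n} λ c → trans (sum-const n 1) (*-identityʳ n)) (sum-const k n)

      all-dense : weight all ≤ B * W * edges all
      all-dense rewrite card-all | edges-all = dense

      L>0 : ∀ {a} → 1 ≤ a → 1 ≤ L a
      L>0 1≤a = begin
        1                  ≤⟨ >-nonZero⁻¹ W ⟩
        W                  ≡⟨ *-identityʳ W ⟨
        W * 1              ≤⟨ m≤n+m (W * 1) (1 * L 0) ⟩
        1 * L 0 + W * 1    ≤⟨ L-increment 0 1 ⟩
        1 * L 1            ≡⟨ *-identityˡ (L 1) ⟩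
        L 1                ≤⟨ L-mono-≤ 1≤a ⟩
        _                  ∎
        where open ≤-Reasoning

      -- A single vertex spans no edge but has positive weight, so it cannot be dense.
      dense⇒2≤card : ∀ {H} → 1 ≤ card H → weight H ≤ B * W * edges H → 2 ≤ card H
      dense⇒2≤card {H} 1≤h H-dense = ≰⇒> λ h≤1 → contradiction
        (≤-trans (*-mono-≤ (>-nonZero⁻¹ k) (*-mono-≤ 1≤h (L>0 1≤h)))
          (≤-trans H-dense (≤-reflexive (trans (cong (B * W *_) (edges-trivial H h≤1)) (*-zeroʳ (B * W))))))
        λ()

    -- The hypothesis `dense` starts the descent at the whole vertex set; any vertex of the
    -- resulting minimal set can be the root, and its gap function satisfies the hypotheses of
    -- `Decay` with `M = 2 * B`.
    rainbow-bound : ∀ t → 4 * (2 * B * t) ≤ k → 2 ^ t ≤ 4 * τ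
    rainbow-bound with minimalDense all (≤-trans 1≤N (≤-reflexive (sym card-all))) all-dense
    ... | H , 1≤h , H-minimal with card>0⇒∃ H 1≤h
    ...   | root , root∈H = 2^t≤4*τ W τ gap⊥≤ (gap-pair H root root∈H acyclic 2≤h) {{m*n≢0 2 B}}
      where
      open Decay (gap H root root∈H) (2 * B) (gap-antitone H root root∈H) (gap-contraction H root root∈H B H-minimal)
      2≤h : 2 ≤ card H
      2≤h = dense⇒2≤card 1≤h (proj₁ H-minimal)
      gap⊥≤ : gap H root root∈H ⊥ ≤ W * τ
      gap⊥≤ = ≤-trans (m∸n≤m (L (card H)) (L (size H root root∈H ⊥)))
                (≤-trans (L-mono-≤ (≤-trans (card-mono-≤ {X = H} {Y = all} λ _ _ → refl) (≤-reflexive card-all))) LN≤)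

-- Cayley graphs

-- Induction on `m`: take out the value `π zero` and regard the remaining values as an injection
-- into what is left.
sum-injective-≤ : ∀ {m n} (π : Fin m → Fin n) → (∀ {i j} → π i ≡ π j → i ≡ j) →
  ∀ (f : Fin n → ℕ) → sum (f ∘ π) ≤ sum f
sum-injective-≤ {zero}          π π-inj f = z≤n
sum-injective-≤ {suc m} {zero}  π π-inj f with () ← π zero
sum-injective-≤ {suc m} {suc n} π π-inj f = begin
  f p + sum (f ∘ π ∘ suc)                ≡⟨ cong (f p +_) (sum-cong-≗ λ i → cong f (sym (Fin.punchIn-punchOut (p≢ i)))) ⟩
  f p + sum (f ∘ punchIn p ∘ rest)
    ≤⟨ +-monoʳ-≤ (f p) (sum-injective-≤ rest (Fin.suc-injective ∘ π-inj ∘ Fin.punchOut-injective (p≢ _) (p≢ _)) (f ∘ punchIn p)) ⟩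
  f p + sum (f ∘ punchIn p)              ≡⟨ sum-remove {i = p} f ⟨
  sum f                                  ∎
  where
  open ≤-Reasoning
  p : Fin (suc n)
  p = π zero
  p≢ : ∀ i → p ≢ π (suc i)
  p≢ i = Fin.0≢1+n ∘ π-inj
  rest : Fin m → Fin n
  rest i = punchOut (p≢ i)

sum-splitAt : ∀ m {n} (f : Fin (m + n) → ℕ) → sum f ≡ sum (f ∘ (_↑ˡ n)) + sum (f ∘ (m ↑ʳ_))
sum-splitAt zero    f = refl
sum-splitAt (suc m) f = trans (cong (f zero +_) (sum-splitAt m (f ∘ suc))) (sym (+-assoc (f zero) _ _))

module _ {c ℓ} (S : Setoid c ℓ) where
  private module S = Setoid S

  unique⇒lookup-injective : ∀ {xs} → UniqueSetoid.Unique S xs → ∀ {i j} → (xs ‼ i) S.≈ (xs ‼ j) → i ≡ j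
  unique⇒lookup-injective (x∉ ∷ xs!) {zero}  {zero}  eq = refl
  unique⇒lookup-injective (x∉ ∷ xs!) {zero}  {suc j} eq = contradiction eq (All.lookup x∉ (∈-lookup j))
  unique⇒lookup-injective (x∉ ∷ xs!) {suc i} {zero}  eq = contradiction (S.sym eq) (All.lookup x∉ (∈-lookup i))
  unique⇒lookup-injective (x∉ ∷ xs!) {suc i} {suc j} eq = cong suc (unique⇒lookup-injective xs! eq)

-- Powers and binary logarithms

n<2^n : ∀ n → n < 2 ^ n
n<2^n zero    = s≤s z≤n
n<2^n (suc n) = ≤-trans (+-mono-≤ (m^n>0 2 n) (n<2^n n)) (≤-reflexive (cong (2 ^ n +_) (sym (+-identityʳ (2 ^ n)))))

n<2^1+⌊log₂n⌋ : ∀ n → n < 2 ^ suc ⌊log₂ n ⌋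
n<2^1+⌊log₂n⌋ n = ≰⇒> λ 2^≤n → contradiction
  (≤-trans (≤-reflexive (sym (⌊log₂[2^n]⌋≡n (suc ⌊log₂ n ⌋)))) (⌊log₂⌋-mono-≤ 2^≤n)) (<-irrefl refl)

m<[1+m/n]*n : ∀ m n → .{{_ : NonZero n}} → m < suc (m / n) * n
m<[1+m/n]*n m n = ≤-trans (s≤s (≤-reflexive (m≡m%n+[m/n]*n m n))) (+-monoˡ-≤ _ (m%n<n m n))

-- From n ≤ q (n/q + 1) ≤ q 2^(n/q), with the quotient rounded down, raised to the power `q`. This
-- turns a power of log log |A| into a single factor log |A|.
^-≤-*2^ : ∀ q n → .{{_ : NonZero q}} → n ^ q ≤ q ^ q * 2 ^ n
^-≤-*2^ q n = begin
  n ^ q                          ≤⟨ ^-monoˡ-≤ q (<⇒≤ (m<[1+m/n]*n n q)) ⟩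
  (suc (n / q) * q) ^ q          ≤⟨ ^-monoˡ-≤ q (*-monoˡ-≤ q (n<2^n (n / q))) ⟩
  (2 ^ (n / q) * q) ^ q          ≡⟨ ^-distribʳ-* q (2 ^ (n / q)) q ⟩
  (2 ^ (n / q)) ^ q * q ^ q      ≡⟨ *-comm _ (q ^ q) ⟩
  q ^ q * (2 ^ (n / q)) ^ q      ≡⟨ cong (q ^ q *_) (^-*-assoc 2 (n / q) q) ⟩
  q ^ q * 2 ^ (n / q * q)        ≤⟨ *-monoʳ-≤ (q ^ q) (^-monoʳ-≤ 2 (m/n*n≤m n q)) ⟩
  q ^ q * 2 ^ n                  ∎
  where open ≤-Reasoning

-- The bipartite Cayley graph of S between A and the product set

module CayleyGraph {c ℓ} (G : Group c ℓ) (A : List (Group.Carrier G)) (A! : FiniteSubset G A)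
  (Π : List (Group.Carrier G)) {k : ℕ} (S : Fin k → Group.Carrier G)
  (A∙S⊆Π : ∀ i c → Membership._∈_ (Group.setoid G) (Group._∙_ G (A ‼ i) (S c)) Π)
  where

  open Group G hiding (refl; sym; trans)
  open GroupProperties G using (∙-cancelʳ; identityʳ-unique)
  open import Relation.Binary.Reasoning.Setoid setoid

  private
    n l : ℕ
    n = length A
    l = length Π

  product : Fin k → Fin n → Fin l
  product c i = index (A∙S⊆Π i c)

  -- Vertices are list positions rather than group elements, so the two sides stay disjoint even if
  -- `A` meets `Π`. A position determines its element, but not conversely.
  src tgt : Fin k → Fin n → Fin (n + l)
  src c i = i ↑ˡ l
  tgt c i = n ↑ʳ product c i

  product-≈ : ∀ c i → (A ‼ i) ∙ S c ≈ (Π ‼ product c i)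
  product-≈ c i = lookup-index (A∙S⊆Π i c)

  product-injective : ∀ c {i j} → product c i ≡ product c j → i ≡ j
  product-injective c {i} {j} eq = unique⇒lookup-injective setoid A! (∙-cancelʳ (S c) _ _ (begin
    (A ‼ i) ∙ S c        ≈⟨ product-≈ c i ⟩
    (Π ‼ product c i)    ≡⟨ cong (Π ‼_) eq ⟩
    (Π ‼ product c j)    ≈⟨ product-≈ c j ⟨
    (A ‼ j) ∙ S c        ∎))

  matching : ∀ c (f : Fin (n + l) → ℕ) → sum (λ i → f (src c i) + f (tgt c i)) ≤ sum f
  matching c f = ≤-trans (≤-reflexive (∑-distrib-+ (f ∘ src c) (f ∘ tgt c)))
    (≤-trans (+-monoʳ-≤ (sum (f ∘ src c)) (sum-injective-≤ (product c) (product-injective c) (f ∘ (n ↑ʳ_))))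
             (≤-reflexive (sym (sum-splitAt n f))))

  open Rainbow src tgt matching

  element : Fin (n + l) → Carrier
  element v = [ (A ‼_) , (Π ‼_) ]′ (splitAt n v)

  element-src : ∀ c i → element (src c i) ≡ (A ‼ i)
  element-src c i = cong [ _ , _ ]′ (Fin.splitAt-↑ˡ n i l)

  element-tgt : ∀ c i → element (tgt c i) ≡ (Π ‼ product c i)
  element-tgt c i = cong [ _ , _ ]′ (Fin.splitAt-↑ʳ n l (product c i))

  edge-≈ : ∀ c i → element (src c i) ∙ S c ≈ element (tgt c i)
  edge-≈ c i = begin
    element (src c i) ∙ S c    ≡⟨ cong (_∙ S c) (element-src c i) ⟩
    (A ‼ i) ∙ S c              ≈⟨ product-≈ c i ⟩
    (Π ‼ product c i)          ≡⟨ element-tgt c i ⟨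
    element (tgt c i)          ∎

  walk-evalWord : ∀ {u w v} → Walk u w v → element v ≈ element u ∙ evalWord G S w
  walk-evalWord [] = Group.sym G (identityʳ _)
  walk-evalWord {v = v} (forward {c} {i} {w} p) = begin
    element v                                        ≈⟨ walk-evalWord p ⟩
    element (tgt c i) ∙ evalWord G S w               ≈⟨ ∙-congʳ (edge-≈ c i) ⟨
    (element (src c i) ∙ S c) ∙ evalWord G S w       ≈⟨ assoc _ _ _ ⟩
    element (src c i) ∙ (S c ∙ evalWord G S w)       ∎
  walk-evalWord {v = v} (backward {c} {i} {w} p) = begin
    element v                                                  ≈⟨ walk-evalWord p ⟩
    element (src c i) ∙ evalWord G S w                         ≈⟨ ∙-congʳ (identityʳ _) ⟨
    (element (src c i) ∙ ε) ∙ evalWord G S w                   ≈⟨ ∙-congʳ (∙-congˡ (inverseʳ (S c))) ⟨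
    (element (src c i) ∙ (S c ∙ S c ⁻¹)) ∙ evalWord G S w      ≈⟨ ∙-congʳ (assoc _ _ _) ⟨
    ((element (src c i) ∙ S c) ∙ S c ⁻¹) ∙ evalWord G S w      ≈⟨ ∙-congʳ (∙-congʳ (edge-≈ c i)) ⟩
    (element (tgt c i) ∙ S c ⁻¹) ∙ evalWord G S w              ≈⟨ assoc _ _ _ ⟩
    element (tgt c i) ∙ (S c ⁻¹ ∙ evalWord G S w)              ∎

  -- A closed walk multiplies its base element by its word without changing it, so the word
  -- evaluates to the identity; rainbow means that its letters are distinct.
  dissociated⇒noRainbowCycle : Dissociated G S → NoRainbowCycle
  dissociated⇒noRainbowCycle dissociated v []      w! p = refl
  dissociated⇒noRainbowCycle dissociated v (x ∷ w) w! p = contradiction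
    (identityʳ-unique (element v) (evalWord G S (x ∷ w)) (Group.sym G (walk-evalWord p)))
    (dissociated (x ∷ w) (λ ()) w!)

-- The bound with exponent 1 + p / q for arbitrary positive p and q

theorem1p7 : {c ℓ : Level} → (K : ℕ) → 1 ≤ K →
    (p q : ℕ) → 1 ≤ p → 1 ≤ q →
    Σ ℕ λ C → Σ ℕ λ N →
    (G : Group c ℓ) → (A : List (Group.Carrier G)) → FiniteSubset G A →
    ProductSetAtMost G A (K * length A) → N ≤ length A →
    (k : ℕ) → (S : Fin k → Group.Carrier G) → DissociatedSubsetOf G A S →
    k ^ q ≤ C * ⌊log₂ length A ⌋ ^ (q + p)
theorem1p7 K 1≤K p (suc q-1) 1≤p 1≤q =
  -- The first factor comes from `4M≤`, the second from (t + 1)^q ≤ q^q 2^(t + 1) together with 2^t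
  -- ≤ 4 E log |A|. The threshold 2 makes the logarithm at least 1.
  (8 * suc K * E) ^ q * (q ^ q * (8 * E)) , 2 , bound
  where
  q E : ℕ
  q = suc q-1
  E = 2 * (K + 3)

  bound : (G : Group _ _) → (A : List (Group.Carrier G)) → FiniteSubset G A →
    ProductSetAtMost G A (K * length A) → 2 ≤ length A →
    (k : ℕ) → (S : Fin k → Group.Carrier G) → DissociatedSubsetOf G A S →
    k ^ q ≤ (8 * suc K * E) ^ q * (q ^ q * (8 * E)) * ⌊log₂ length A ⌋ ^ (q + p)
  -- The exponent is a successor, so the left side is 0.
  bound G A A! _ 2≤n zero S _ = z≤n
  bound G A A! (Π , l≤Kn , A∙A⊆Π) 2≤n k@(suc _) S (_ , S⊆A , dissociated) = begin
    k ^ q                                                ≤⟨ ^-monoˡ-≤ q (<⇒≤ (m<[1+m/n]*n k (4 * M))) ⟩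
    (suc t * (4 * M)) ^ q                                ≡⟨ ^-distribʳ-* q (suc t) (4 * M) ⟩
    suc t ^ q * (4 * M) ^ q                              ≤⟨ *-mono-≤ (^-≤-*2^ q (suc t)) (^-monoˡ-≤ q 4M≤) ⟩
    q ^ q * (2 * 2 ^ t) * (8 * suc K * E * λn) ^ q
      ≤⟨ *-monoˡ-≤ _ (*-monoʳ-≤ (q ^ q) (*-monoʳ-≤ 2 (≤-trans 2^t≤4τ (*-monoʳ-≤ 4 τ≤)))) ⟩
    q ^ q * (2 * (4 * (E * λn))) * (8 * suc K * E * λn) ^ q
      ≡⟨ cong (q ^ q * (2 * (4 * (E * λn))) *_) (^-distribʳ-* q (8 * suc K * E) λn) ⟩
    q ^ q * (2 * (4 * (E * λn))) * ((8 * suc K * E) ^ q * λn ^ q)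
      ≡⟨ collect (q ^ q) E λn ((8 * suc K * E) ^ q) (λn ^ q) ⟩
    (8 * suc K * E) ^ q * (q ^ q * (8 * E)) * (λn ^ q * λn)
      -- The bound on `2 ^ t` leaves one spare factor log |A|, which `1 ≤ p` absorbs.
      ≤⟨ *-monoʳ-≤ ((8 * suc K * E) ^ q * (q ^ q * (8 * E))) (*-monoʳ-≤ (λn ^ q) λn≤λn^p) ⟩
    (8 * suc K * E) ^ q * (q ^ q * (8 * E)) * (λn ^ q * λn ^ p)
      ≡⟨ cong ((8 * suc K * E) ^ q * (q ^ q * (8 * E)) *_) (^-distribˡ-+-* λn q p) ⟨
    (8 * suc K * E) ^ q * (q ^ q * (8 * E)) * λn ^ (q + p) ∎
    where
    open ≤-Reasoning
    open CayleyGraph G A A! Π S (λ i c → A∙A⊆Π (MembershipProperties.∈-lookup (Group.setoid G) A i) (S⊆A c))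

    n l λn T τ B M t : ℕ
    n = length A
    l = length Π
    λn = ⌊log₂ n ⌋
    -- The graph has at most `suc K * n` vertices, hence at most `2 ^ T`, and `τ` is then the dyadic
    -- bound for the logarithm. `B` is the smallest factor for which these two estimates give
    -- `dense`, and `t` is the largest number with `t * (4 * M) ≤ k`.
    T = K + suc λn
    τ = 2 * suc T
    B = suc K * τ
    M = 2 * B
    t = k / (4 * M)

    open HarmonicLog (2 ^ T)

    n+l≤ : n + l ≤ suc K * n
    n+l≤ = +-monoʳ-≤ n l≤Kn

    n+l≤2^T : n + l ≤ 2 ^ T
    n+l≤2^T = begin
      n + l                    ≤⟨ n+l≤ ⟩
      suc K * n                ≤⟨ *-mono-≤ (n<2^n K) (<⇒≤ (n<2^1+⌊log₂n⌋ n)) ⟩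
      2 ^ K * 2 ^ suc λn       ≡⟨ ^-distribˡ-+-* 2 K (suc λn) ⟨
      2 ^ T                    ∎

    L≤ : L (n + l) ≤ 2 ^ T * τ
    L≤ = ≤-trans (L-mono-≤ n+l≤2^T) (L[2^i]≤ T T ≤-refl)

    dense : k * ((n + l) * L (n + l)) ≤ B * 2 ^ T * (k * n)
    dense = begin
      k * ((n + l) * L (n + l))          ≤⟨ *-monoʳ-≤ k (*-mono-≤ n+l≤ L≤) ⟩
      k * (suc K * n * (2 ^ T * τ))      ≡⟨ rearrange k (suc K) n (2 ^ T) τ ⟩
      B * 2 ^ T * (k * n)                ∎
      where
      rearrange : ∀ k a n w τ → k * (a * n * (w * τ)) ≡ a * τ * w * (k * n)
      rearrange = solve-∀

    2^t≤4τ : 2 ^ t ≤ 4 * τ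
    2^t≤4τ = RainbowBound.rainbow-bound src tgt matching (2 ^ T) L L-mono-≤ L-increment B τ
      {{_}} {{m^n≢0 2 T}}
      (≤-trans (≤-trans (s≤s z≤n) 2≤n) (m≤m+n n l)) L≤ dense (dissociated⇒noRainbowCycle dissociated) t
      (≤-trans (≤-reflexive (commute M t)) (m/n*n≤m k (4 * M)))
      where
      commute : ∀ m t → 4 * (m * t) ≡ t * (4 * m)
      commute = solve-∀

    1≤λn : 1 ≤ λn
    1≤λn = ⌊log₂⌋-mono-≤ 2≤n

    τ≤ : τ ≤ E * λn
    τ≤ = begin
      2 * suc (K + suc λn)         ≡⟨ arith₁ K λn ⟩
      2 * ((K + 2) * 1 + λn)       ≤⟨ *-monoʳ-≤ 2 (+-monoˡ-≤ λn (*-monoʳ-≤ (K + 2) 1≤λn)) ⟩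
      2 * ((K + 2) * λn + λn)      ≡⟨ arith₂ K λn ⟩
      E * λn                       ∎
      where
      arith₁ : ∀ K x → 2 * suc (K + suc x) ≡ 2 * ((K + 2) * 1 + x)
      arith₁ = solve-∀
      arith₂ : ∀ K x → 2 * ((K + 2) * x + x) ≡ 2 * (K + 3) * x
      arith₂ = solve-∀

    4M≤ : 4 * M ≤ 8 * suc K * E * λn
    4M≤ = begin
      4 * (2 * (suc K * τ))        ≤⟨ *-monoʳ-≤ 4 (*-monoʳ-≤ 2 (*-monoʳ-≤ (suc K) τ≤)) ⟩
      4 * (2 * (suc K * (E * λn))) ≡⟨ arith (suc K) E λn ⟩
      8 * suc K * E * λn           ∎
      where
      arith : ∀ a e x → 4 * (2 * (a * (e * x))) ≡ 8 * a * e * x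
      arith = solve-∀

    λn≤λn^p : λn ≤ λn ^ p
    λn≤λn^p = ≤-trans (≤-reflexive (sym (*-identityʳ λn))) (^-monoʳ-≤ λn {{>-nonZero 1≤λn}} 1≤p)

    collect : ∀ a e x b y → a * (2 * (4 * (e * x))) * (b * y) ≡ b * (a * (8 * e)) * (y * x)
    collect = solve-∀
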